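{- Let $G$ be a finite group with an abelian subgroup $H$ of index $2$. Suppose that $X=\mathrm{Cay}(G,S)$, where $S\subseteq G\setminus\{1_G\}$ is inverse-closed, admits perfect state transfer, and let $T$ be its PST involution. If $T=L_s$ for some $s\in G\setminus H$, then $\langle R(H),L_s\rangle\le\mathrm{Aut}(X)$ is an abelian regular subgroup of order $|G|$. In particular, $X$ is a Cayley graph of the abelian group $H\times C_2$.
   Context: $\mathrm{Cay}(G,S)$ is the graph with vertex set $G$ in which $g\sim h$ if and only if $hg^{ -1}\in S$. A graph $X$ is a Cayley graph of a group $K$ if $X\cong\mathrm{Cay}(K,S')$ for some inverse-closed $S'\subseteq K\setminus\{1_K\}$. For $a\in G$, $R_a$ and $L_a$ denote the permutations $x\mapsto xa$ and $x\mapsto ax$ of $G$; $R(H)=\{R_h:h\in H\}$. A permutation group is regular if it is transitive with trivial point stabilizers. $C_2$ is the cyclic group of order two. For a graph $X$ with adjacency matrix $A$, put $U(t)=\exp(itA)$. $X$ admits perfect state transfer (PST) at time $\tau$ if $|U(\tau)_{v,u}|=1$ for some distinct vertices $u,v$. For a vertex-transitive graph $X$ with PST at time $\tau$, it is known that $U(\tau)$ is a scalar multiple of a permutation matrix $T$ of order two without fixed points which lies in the centre of $\mathrm{Aut}(X)$; $T$, regarded as a permutation of $V(X)$, is called the PST involution of $X$. -}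

module Defs where

open import Level using (Level; _⊔_; suc)
open import Data.Bool.Base using (if_then_else_)
open import Data.Nat.Base as ℕ using (ℕ; zero; _!)
import Data.Nat.Properties as ℕ
open import Data.Integer.Base using (+_)
open import Data.Fin.Base using (Fin; toℕ)
import Data.Fin.Properties as Fin
open import Data.Rational.Base as ℚ using (ℚ; 0ℚ; 1ℚ; ½)
import Data.Rational.Properties as ℚ
import Data.Rational.Solver as ℚ-Solver
open import Data.Parity.Properties using () renaming (+-0-group to C₂) public
open import Data.Product.Base using (Σ; ∃; ∃₂; _×_; _,_; proj₁; proj₂)
open import Data.Sum.Base using (inj₁; inj₂)
open import Function.Base using (_on_; _∘_; id)
open import Function.Bundles using (Inverse; _⇔_; mk⇔; Equivalence)
import Function.Construct.Composition as Comp
import Function.Construct.Identity as Id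
import Function.Construct.Symmetry as Symm
open import Relation.Nullary using (¬_; does)
open import Relation.Nullary.Decidable using (map′)
open import Relation.Unary as U using (Pred; _∈_; _∉_)
open import Relation.Binary using (Setoid; Rel; Symmetric; Irreflexive; Decidable; _Respects_; _Respects₂_; IsEquivalence)
open import Relation.Binary.PropositionalEquality as ≡ using (_≡_; cong; cong₂; subst)
open import Algebra.Bundles using (Group; CommutativeRing)
open import Algebra.Definitions using (Commutative)
import Algebra.Construct.DirectProduct as DirectProduct
import Algebra.Properties.Group as GroupProperties
import Algebra.Properties.Monoid.Sum as MonoidSum
import Algebra.Properties.Ring as RingProperties
import Algebra.Solver.Ring.NaturalCoefficients.Default as NaturalCoefficients

private
  variable
    a b c ℓ ℓ′ e h p s : Level

-- ℝ is the setoid of Cauchy sequences of rationals; the difference of two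
-- equal reals is a null sequence.
module Real where

  open import Data.Rational.Base using (∣_∣; _<_; _≤_; _+_; _*_; _-_; -_)

  record ℝ : Set where
    field
      seq    : ℕ → ℚ
      cauchy : ∀ ε → 0ℚ < ε →
               ∃ λ N → ∀ m n → N ℕ.≤ m → N ℕ.≤ n → ∣ seq m - seq n ∣ < ε

  open ℝ public

  infix 4 _≈_ _≤ᵣ_

  record _≈_ (x y : ℝ) : Set where
    constructor mk≈
    field
      close : ∀ ε → 0ℚ < ε → ∃ λ N → ∀ n → N ℕ.≤ n → ∣ seq x n - seq y n ∣ < ε

  record _≤ᵣ_ (x y : ℝ) : Set where
    constructor mk≤
    field
      below : ∀ ε → 0ℚ < ε → ∃ λ N → ∀ n → N ℕ.≤ n → seq x n < seq y n + ε

  open _≈_ public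
  open _≤ᵣ_ public

  private
    open ℚ-Solver.+-*-Solver
    open ℚ.≤-Reasoning

    ∣0∣< : ∀ {p ε} → p ≡ 0ℚ → 0ℚ < ε → ∣ p ∣ < ε
    ∣0∣< ≡.refl 0<ε = 0<ε

    ½+½ : ∀ ε → ½ * ε + ½ * ε ≡ ε
    ½+½ = solve 1 (λ ε → con ½ :* ε :+ con ½ :* ε := ε) ≡.refl

    0<½* : ∀ {ε} → 0ℚ < ε → 0ℚ < ½ * ε
    0<½* {ε} 0<ε = begin-strict
      0ℚ      ≡⟨ ℚ.*-zeroʳ ½ ⟨
      ½ * 0ℚ  <⟨ ℚ.*-monoʳ-<-pos ½ 0<ε ⟩
      ½ * ε   ∎

    halves : ∀ {x y ε} → x < ½ * ε → y < ½ * ε → x + y < ε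
    halves {ε = ε} x< y< = subst (_ <_) (½+½ ε) (ℚ.+-mono-< x< y<)

    ∣-∣-swap : ∀ x y → ∣ x - y ∣ ≡ ∣ y - x ∣
    ∣-∣-swap x y = ≡.trans (≡.sym (ℚ.∣-p∣≡∣p∣ (x - y)))
      (cong ∣_∣ (solve 2 (λ x y → :- (x :- y) := y :- x) ≡.refl x y))

    ∣-∣-triangle : ∀ x y z → ∣ x - z ∣ ≤ ∣ x - y ∣ + ∣ y - z ∣
    ∣-∣-triangle x y z = begin
      ∣ x - z ∣              ≡⟨ cong ∣_∣ (solve 3 (λ x y z → x :- z := (x :- y) :+ (y :- z)) ≡.refl x y z) ⟩
      ∣ (x - y) + (y - z) ∣  ≤⟨ ℚ.∣p+q∣≤∣p∣+∣q∣ (x - y) (y - z) ⟩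
      ∣ x - y ∣ + ∣ y - z ∣  ∎

    ∣∣x∣-∣y∣∣≤∣x-y∣ : ∀ x y → ∣ ∣ x ∣ - ∣ y ∣ ∣ ≤ ∣ x - y ∣
    ∣∣x∣-∣y∣∣≤∣x-y∣ x y with ℚ.∣p∣≡p∨∣p∣≡-p (∣ x ∣ - ∣ y ∣)
    ... | inj₁ eq = subst (_≤ ∣ x - y ∣) (≡.sym eq) (one x y)
      where
      one : ∀ x y → ∣ x ∣ - ∣ y ∣ ≤ ∣ x - y ∣
      one x y = begin
        ∣ x ∣ - ∣ y ∣                ≡⟨ cong (λ z → ∣ z ∣ - ∣ y ∣) (solve 2 (λ x y → x := (x :- y) :+ y) ≡.refl x y) ⟩
        ∣ (x - y) + y ∣ - ∣ y ∣      ≤⟨ ℚ.+-monoˡ-≤ (- ∣ y ∣) (ℚ.∣p+q∣≤∣p∣+∣q∣ (x - y) y) ⟩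
        (∣ x - y ∣ + ∣ y ∣) - ∣ y ∣  ≡⟨ solve 2 (λ u v → (u :+ v) :- v := u) ≡.refl ∣ x - y ∣ ∣ y ∣ ⟩
        ∣ x - y ∣                    ∎
    ... | inj₂ eq = subst (_≤ ∣ x - y ∣) (≡.sym eq) (begin
        - (∣ x ∣ - ∣ y ∣)            ≡⟨ solve 2 (λ u v → :- (u :- v) := v :- u) ≡.refl ∣ x ∣ ∣ y ∣ ⟩
        ∣ y ∣ - ∣ x ∣                ≡⟨ cong (λ z → ∣ z ∣ - ∣ x ∣) (solve 2 (λ x y → y := (y :- x) :+ x) ≡.refl x y) ⟩
        ∣ (y - x) + x ∣ - ∣ x ∣      ≤⟨ ℚ.+-monoˡ-≤ (- ∣ x ∣) (ℚ.∣p+q∣≤∣p∣+∣q∣ (y - x) x) ⟩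
        (∣ y - x ∣ + ∣ x ∣) - ∣ x ∣  ≡⟨ solve 2 (λ u v → (u :+ v) :- v := u) ≡.refl ∣ y - x ∣ ∣ x ∣ ⟩
        ∣ y - x ∣                    ≡⟨ ∣-∣-swap y x ⟩
        ∣ x - y ∣                    ∎)

    sum-estimate : ∀ x y z w → ∣ (x + y) - (z + w) ∣ ≤ ∣ x - z ∣ + ∣ y - w ∣
    sum-estimate x y z w = begin
      ∣ (x + y) - (z + w) ∣  ≡⟨ cong ∣_∣ (solve 4 (λ x y z w → (x :+ y) :- (z :+ w) := (x :- z) :+ (y :- w)) ≡.refl x y z w) ⟩
      ∣ (x - z) + (y - w) ∣  ≤⟨ ℚ.∣p+q∣≤∣p∣+∣q∣ (x - z) (y - w) ⟩
      ∣ x - z ∣ + ∣ y - w ∣  ∎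

    neg-estimate : ∀ x y → ∣ (- x) - (- y) ∣ ≡ ∣ x - y ∣
    neg-estimate x y = ≡.trans (cong ∣_∣ (solve 2 (λ x y → (:- x) :- (:- y) := y :- x) ≡.refl x y)) (∣-∣-swap y x)

    product-estimate : ∀ x y z w → ∣ x * y - z * w ∣ ≤ ∣ x ∣ * ∣ y - w ∣ + ∣ w ∣ * ∣ x - z ∣
    product-estimate x y z w = begin
      ∣ x * y - z * w ∣                      ≡⟨ cong ∣_∣ (solve 4 (λ x y z w → x :* y :- z :* w := x :* (y :- w) :+ w :* (x :- z)) ≡.refl x y z w) ⟩
      ∣ x * (y - w) + w * (x - z) ∣          ≤⟨ ℚ.∣p+q∣≤∣p∣+∣q∣ (x * (y - w)) (w * (x - z)) ⟩
      ∣ x * (y - w) ∣ + ∣ w * (x - z) ∣      ≡⟨ cong₂ _+_ (ℚ.∣p*q∣≡∣p∣*∣q∣ x (y - w)) (ℚ.∣p*q∣≡∣p∣*∣q∣ w (x - z)) ⟩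
      ∣ x ∣ * ∣ y - w ∣ + ∣ w ∣ * ∣ x - z ∣  ∎

    scale : ∀ B ε → 0ℚ < B → 0ℚ < ε →
            ∃ λ δ → 0ℚ < δ × (∀ {x y} → ∣ x ∣ ≤ B → ∣ y ∣ < δ → ∣ x ∣ * ∣ y ∣ < ε)
    scale B ε 0<B 0<ε = δ , 0<δ , λ {x} {y} x≤B y<δ → begin-strict
        ∣ x ∣ * ∣ y ∣  ≤⟨ ℚ.*-monoʳ-≤-nonNeg ∣ y ∣ {{ℚ.∣-∣-nonNeg y}} x≤B ⟩
        B * ∣ y ∣      <⟨ ℚ.*-monoʳ-<-pos B y<δ ⟩
        B * δ          ≡⟨ ℚ.*-comm B δ ⟩
        (ε * r) * B    ≡⟨ ℚ.*-assoc ε r B ⟩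
        ε * (r * B)    ≡⟨ cong (ε *_) (ℚ.*-inverseˡ B) ⟩
        ε * 1ℚ         ≡⟨ ℚ.*-identityʳ ε ⟩
        ε              ∎
      where
      instance
        B⁺ = ℚ.positive 0<B
        B≢0 = ℚ.pos⇒nonZero B
        ε⁺ = ℚ.positive 0<ε
      r = ℚ.1/ B
      instance
        r⁺ = ℚ.1/pos⇒pos B
      δ = ε * r
      0<δ : 0ℚ < δ
      0<δ = ℚ.positive⁻¹ δ {{ℚ.pos*pos⇒pos ε r}}

    bound : (x : ℝ) → ∃₂ λ B N → 0ℚ < B × (∀ n → N ℕ.≤ n → ∣ seq x n ∣ ≤ B)
    bound x = let (N , H) = cauchy x 1ℚ (ℚ.positive⁻¹ 1ℚ) ; y = seq x N in
      1ℚ + ∣ y ∣ , N ,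
      (begin-strict
        0ℚ          <⟨ ℚ.positive⁻¹ 1ℚ ⟩
        1ℚ          ≡⟨ ℚ.+-identityʳ 1ℚ ⟨
        1ℚ + 0ℚ     ≤⟨ ℚ.+-monoʳ-≤ 1ℚ (ℚ.0≤∣p∣ y) ⟩
        1ℚ + ∣ y ∣  ∎) ,
      λ n N≤n → begin
        ∣ seq x n ∣            ≡⟨ cong ∣_∣ (solve 2 (λ u v → u := (u :- v) :+ v) ≡.refl (seq x n) y) ⟩
        ∣ (seq x n - y) + y ∣  ≤⟨ ℚ.∣p+q∣≤∣p∣+∣q∣ (seq x n - y) y ⟩
        ∣ seq x n - y ∣ + ∣ y ∣  ≤⟨ ℚ.+-monoˡ-≤ ∣ y ∣ (ℚ.<⇒≤ (H n N N≤n ℕ.≤-refl)) ⟩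
        1ℚ + ∣ y ∣             ∎

    pointwise : ∀ {x y} → (∀ n → seq x n ≡ seq y n) → x ≈ y
    pointwise {x} {y} eq = mk≈ λ ε 0<ε → 0 , λ n _ →
      ∣0∣< (≡.trans (cong (_- seq y n) (eq n)) (ℚ.+-inverseʳ (seq y n))) 0<ε

    ⊔ˡ : ∀ {i} M N → M ℕ.⊔ N ℕ.≤ i → M ℕ.≤ i
    ⊔ˡ = ℕ.m⊔n≤o⇒m≤o
    ⊔ʳ : ∀ {i} M N → M ℕ.⊔ N ℕ.≤ i → N ℕ.≤ i
    ⊔ʳ = ℕ.m⊔n≤o⇒n≤o

  fromℚ : ℚ → ℝ
  fromℚ q = record
    { seq    = λ _ → q
    ; cauchy = λ ε 0<ε → 0 , λ _ _ _ _ → ∣0∣< (ℚ.+-inverseʳ q) 0<ε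
    }

  infixl 6 _⊕_
  infixl 7 _⊛_

  _⊕_ : ℝ → ℝ → ℝ
  x ⊕ y = record
    { seq    = λ n → seq x n + seq y n
    ; cauchy = λ ε 0<ε →
        let (M , f) = cauchy x (½ * ε) (0<½* 0<ε)
            (N , g) = cauchy y (½ * ε) (0<½* 0<ε)
        in M ℕ.⊔ N , λ m n p q → ℚ.≤-<-trans (sum-estimate (seq x m) (seq y m) (seq x n) (seq y n))
             (halves (f m n (⊔ˡ M N p) (⊔ˡ M N q)) (g m n (⊔ʳ M N p) (⊔ʳ M N q)))
    }

  ⊖_ : ℝ → ℝ
  ⊖ x = record
    { seq    = λ n → - seq x n
    ; cauchy = λ ε 0<ε → let (N , f) = cauchy x ε 0<ε in
        N , λ m n p q → subst (_< ε) (≡.sym (neg-estimate (seq x m) (seq x n))) (f m n p q)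
    }

  _⊛_ : ℝ → ℝ → ℝ
  x ⊛ y = record
    { seq    = λ n → seq x n * seq y n
    ; cauchy = λ ε 0<ε →
        let (A , K , 0<A , x≤A) = bound x
            (B , L , 0<B , y≤B) = bound y
            (δ , 0<δ , small₁) = scale A (½ * ε) 0<A (0<½* 0<ε)
            (η , 0<η , small₂) = scale B (½ * ε) 0<B (0<½* 0<ε)
            (M , f) = cauchy x η 0<η
            (N , g) = cauchy y δ 0<δ
        in (K ℕ.⊔ L) ℕ.⊔ (M ℕ.⊔ N) , λ m n p q →
          let p₁ = ⊔ˡ (K ℕ.⊔ L) (M ℕ.⊔ N) p ; p₂ = ⊔ʳ (K ℕ.⊔ L) (M ℕ.⊔ N) p
              q₁ = ⊔ˡ (K ℕ.⊔ L) (M ℕ.⊔ N) q ; q₂ = ⊔ʳ (K ℕ.⊔ L) (M ℕ.⊔ N) q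
          in ℚ.≤-<-trans (product-estimate (seq x m) (seq y m) (seq x n) (seq y n)) (halves
               (small₁ {seq x m} {seq y m - seq y n} (x≤A m (⊔ˡ K L p₁)) (g m n (⊔ʳ M N p₂) (⊔ʳ M N q₂)))
               (small₂ {seq y n} {seq x m - seq x n} (y≤B n (⊔ʳ K L q₁)) (f m n (⊔ˡ M N p₂) (⊔ˡ M N q₂))))
    }

  ∣_∣ᵣ : ℝ → ℝ
  ∣ x ∣ᵣ = record
    { seq    = λ n → ∣ seq x n ∣
    ; cauchy = λ ε 0<ε → let (N , f) = cauchy x ε 0<ε in
        N , λ m n p q → ℚ.≤-<-trans (∣∣x∣-∣y∣∣≤∣x-y∣ (seq x m) (seq x n)) (f m n p q)
    }

  private
    isEquivalence : IsEquivalence _≈_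
    isEquivalence = record
      { refl  = λ {x} → pointwise (λ _ → ≡.refl)
      ; sym   = λ {x} {y} x≈y → mk≈ λ ε 0<ε → let (N , f) = close x≈y ε 0<ε in
          N , λ n p → subst (_< ε) (∣-∣-swap (seq x n) (seq y n)) (f n p)
      ; trans = λ {x} {y} {z} x≈y y≈z → mk≈ λ ε 0<ε →
          let (M , f) = close x≈y (½ * ε) (0<½* 0<ε)
              (N , g) = close y≈z (½ * ε) (0<½* 0<ε)
          in M ℕ.⊔ N , λ n p → ℚ.≤-<-trans (∣-∣-triangle (seq x n) (seq y n) (seq z n))
               (halves (f n (⊔ˡ M N p)) (g n (⊔ʳ M N p)))
      }

    ⊕-cong : ∀ {x x′ y y′} → x ≈ x′ → y ≈ y′ → x ⊕ y ≈ x′ ⊕ y′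
    ⊕-cong {x} {x′} {y} {y′} x≈ y≈ = mk≈ λ ε 0<ε →
      let (M , f) = close x≈ (½ * ε) (0<½* 0<ε)
          (N , g) = close y≈ (½ * ε) (0<½* 0<ε)
      in M ℕ.⊔ N , λ n p → ℚ.≤-<-trans (sum-estimate (seq x n) (seq y n) (seq x′ n) (seq y′ n))
           (halves (f n (⊔ˡ M N p)) (g n (⊔ʳ M N p)))

    ⊖-cong : ∀ {x y} → x ≈ y → ⊖ x ≈ ⊖ y
    ⊖-cong {x} {y} x≈y = mk≈ λ ε 0<ε → let (N , f) = close x≈y ε 0<ε in
      N , λ n p → subst (_< ε) (≡.sym (neg-estimate (seq x n) (seq y n))) (f n p)

    ⊛-cong : ∀ {x x′ y y′} → x ≈ x′ → y ≈ y′ → x ⊛ y ≈ x′ ⊛ y′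
    ⊛-cong {x} {x′} {y} {y′} x≈ y≈ = mk≈ λ ε 0<ε →
      let (A , K , 0<A , x≤A) = bound x
          (B , L , 0<B , y≤B) = bound y′
          (δ , 0<δ , small₁) = scale A (½ * ε) 0<A (0<½* 0<ε)
          (η , 0<η , small₂) = scale B (½ * ε) 0<B (0<½* 0<ε)
          (M , f) = close x≈ η 0<η
          (N , g) = close y≈ δ 0<δ
      in (K ℕ.⊔ L) ℕ.⊔ (M ℕ.⊔ N) , λ n p →
        let p₁ = ⊔ˡ (K ℕ.⊔ L) (M ℕ.⊔ N) p ; p₂ = ⊔ʳ (K ℕ.⊔ L) (M ℕ.⊔ N) p
        in ℚ.≤-<-trans (product-estimate (seq x n) (seq y n) (seq x′ n) (seq y′ n)) (halves
             (small₁ {seq x n} {seq y n - seq y′ n} (x≤A n (⊔ˡ K L p₁)) (g n (⊔ʳ M N p₂)))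
             (small₂ {seq y′ n} {seq x n - seq x′ n} (y≤B n (⊔ʳ K L p₁)) (f n (⊔ˡ M N p₂))))

  ℝ-ring : CommutativeRing _ _
  ℝ-ring = record
    { Carrier = ℝ
    ; _≈_ = _≈_
    ; _+_ = _⊕_
    ; _*_ = _⊛_
    ; -_  = ⊖_
    ; 0#  = fromℚ 0ℚ
    ; 1#  = fromℚ 1ℚ
    ; isCommutativeRing = record
      { isRing = record
        { +-isAbelianGroup = record
          { isGroup = record
            { isMonoid = record
              { isSemigroup = record
                { isMagma = record { isEquivalence = isEquivalence ; ∙-cong = ⊕-cong }
                ; assoc = λ x y z → pointwise λ n → ℚ.+-assoc (seq x n) (seq y n) (seq z n)
                }
              ; identity = (λ x → pointwise λ n → ℚ.+-identityˡ (seq x n))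
                         , (λ x → pointwise λ n → ℚ.+-identityʳ (seq x n))
              }
            ; inverse = (λ x → pointwise λ n → ℚ.+-inverseˡ (seq x n))
                      , (λ x → pointwise λ n → ℚ.+-inverseʳ (seq x n))
            ; ⁻¹-cong = ⊖-cong
            }
          ; comm = λ x y → pointwise λ n → ℚ.+-comm (seq x n) (seq y n)
          }
        ; *-cong = ⊛-cong
        ; *-assoc = λ x y z → pointwise λ n → ℚ.*-assoc (seq x n) (seq y n) (seq z n)
        ; *-identity = (λ x → pointwise λ n → ℚ.*-identityˡ (seq x n))
                     , (λ x → pointwise λ n → ℚ.*-identityʳ (seq x n))
        ; distrib = (λ x y z → pointwise λ n → ℚ.*-distribˡ-+ (seq x n) (seq y n) (seq z n))
                  , (λ x y z → pointwise λ n → ℚ.*-distribʳ-+ (seq x n) (seq y n) (seq z n))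
        }
      ; *-comm = λ x y → pointwise λ n → ℚ.*-comm (seq x n) (seq y n)
      }
    }

  Converges : (ℕ → ℝ) → ℝ → Set
  Converges x y = ∀ ε → 0ℚ < ε → ∃ λ N → ∀ n → N ℕ.≤ n → ∣ x n ⊕ (⊖ y) ∣ᵣ ≤ᵣ fromℚ ε

open Real using (ℝ; ℝ-ring; fromℚ; _≤ᵣ_) public

module Complexification (R : CommutativeRing c ℓ) where

  open CommutativeRing R

  infix 5 _+i_

  record Complex : Set c where
    constructor _+i_
    field
      re im : Carrier

  open Complex public

  private
    open NaturalCoefficients commutativeSemiring using (solve; _:=_; _:+_; _:*_)

    neg : ∀ {x} → - x ≈ - 1# * x
    neg {x} = sym (RingProperties.-1*x≈-x ring x)

    assoc-re : ∀ x x′ y y′ z z′ →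
      (x * y - x′ * y′) * z - (x * y′ + x′ * y) * z′ ≈
      x * (y * z - y′ * z′) - x′ * (y * z′ + y′ * z)
    assoc-re x x′ y y′ z z′ = trans
      (+-cong (*-congʳ (+-congˡ neg)) neg)
      (trans
        (solve 7 (λ m x x′ y y′ z z′ →
          (x :* y :+ m :* (x′ :* y′)) :* z :+ m :* ((x :* y′ :+ x′ :* y) :* z′) :=
          x :* (y :* z :+ m :* (y′ :* z′)) :+ m :* (x′ :* (y :* z′ :+ y′ :* z)))
          refl (- 1#) x x′ y y′ z z′)
        (sym (+-cong (*-congˡ (+-congˡ neg)) neg)))

    assoc-im : ∀ x x′ y y′ z z′ →
      (x * y - x′ * y′) * z′ + (x * y′ + x′ * y) * z ≈
      x * (y * z′ + y′ * z) + x′ * (y * z - y′ * z′)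
    assoc-im x x′ y y′ z z′ = trans
      (+-congʳ (*-congʳ (+-congˡ neg)))
      (trans
        (solve 7 (λ m x x′ y y′ z z′ →
          (x :* y :+ m :* (x′ :* y′)) :* z′ :+ (x :* y′ :+ x′ :* y) :* z :=
          x :* (y :* z′ :+ y′ :* z) :+ x′ :* (y :* z :+ m :* (y′ :* z′)))
          refl (- 1#) x x′ y y′ z z′)
        (sym (+-congˡ (*-congˡ (+-congˡ neg)))))

    identityˡ-re : ∀ x x′ → 1# * x - 0# * x′ ≈ x
    identityˡ-re x x′ = trans
      (+-cong (*-identityˡ x) (trans (-‿cong (zeroˡ x′)) (RingProperties.-0#≈0# ring)))
      (+-identityʳ x)

    identityˡ-im : ∀ x x′ → 1# * x′ + 0# * x ≈ x′
    identityˡ-im x x′ = trans (+-cong (*-identityˡ x′) (zeroˡ x)) (+-identityʳ x′)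

    distribˡ-re : ∀ x x′ y y′ z z′ →
      x * (y + z) - x′ * (y′ + z′) ≈ (x * y - x′ * y′) + (x * z - x′ * z′)
    distribˡ-re x x′ y y′ z z′ = trans
      (+-congˡ neg)
      (trans
        (solve 7 (λ m x x′ y y′ z z′ →
          x :* (y :+ z) :+ m :* (x′ :* (y′ :+ z′)) :=
          (x :* y :+ m :* (x′ :* y′)) :+ (x :* z :+ m :* (x′ :* z′)))
          refl (- 1#) x x′ y y′ z z′)
        (sym (+-cong (+-congˡ neg) (+-congˡ neg))))

    distribˡ-im : ∀ x x′ y y′ z z′ →
      x * (y′ + z′) + x′ * (y + z) ≈ (x * y′ + x′ * y) + (x * z′ + x′ * z)
    distribˡ-im = solve 6 (λ x x′ y y′ z z′ →
      x :* (y′ :+ z′) :+ x′ :* (y :+ z) := (x :* y′ :+ x′ :* y) :+ (x :* z′ :+ x′ :* z)) refl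

    comm-im : ∀ x x′ y y′ → x * y′ + x′ * y ≈ y * x′ + y′ * x
    comm-im = solve 4 (λ x x′ y y′ → x :* y′ :+ x′ :* y := y :* x′ :+ y′ :* x) refl

    _≋_ : Rel Complex ℓ
    z ≋ w = re z ≈ re w × im z ≈ im w

    _⊠_ : Complex → Complex → Complex
    z ⊠ w = (re z * re w - im z * im w) +i (re z * im w + im z * re w)

    ⊠-comm : ∀ z w → (z ⊠ w) ≋ (w ⊠ z)
    ⊠-comm (x +i x′) (y +i y′) = +-cong (*-comm x y) (-‿cong (*-comm x′ y′)) , comm-im x x′ y y′

    ≋-trans : ∀ {x y z} → x ≋ y → y ≋ z → x ≋ z
    ≋-trans (p , q) (p′ , q′) = trans p p′ , trans q q′

    distribˡᶜ : ∀ x y z → (x ⊠ ((re y + re z) +i (im y + im z))) ≋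
      ((re (x ⊠ y) + re (x ⊠ z)) +i (im (x ⊠ y) + im (x ⊠ z)))
    distribˡᶜ (x +i x′) (y +i y′) (z +i z′) = distribˡ-re x x′ y y′ z z′ , distribˡ-im x x′ y y′ z z′

  complexRing : CommutativeRing c ℓ
  complexRing = record
    { Carrier = Complex
    ; _≈_ = _≋_
    ; _+_ = λ z w → (re z + re w) +i (im z + im w)
    ; _*_ = _⊠_
    ; -_  = λ z → (- re z) +i (- im z)
    ; 0#  = 0# +i 0#
    ; 1#  = 1# +i 0#
    ; isCommutativeRing = record
      { isRing = record
        { +-isAbelianGroup = record
          { isGroup = record
            { isMonoid = record
              { isSemigroup = record
                { isMagma = record
                  { isEquivalence = record
                    { refl  = refl , refl
                    ; sym   = λ (p , q) → sym p , sym q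
                    ; trans = ≋-trans
                    }
                  ; ∙-cong = λ (p , q) (p′ , q′) → +-cong p p′ , +-cong q q′
                  }
                ; assoc = λ _ _ _ → +-assoc _ _ _ , +-assoc _ _ _
                }
              ; identity = (λ _ → +-identityˡ _ , +-identityˡ _) , (λ _ → +-identityʳ _ , +-identityʳ _)
              }
            ; inverse = (λ _ → -‿inverseˡ _ , -‿inverseˡ _) , (λ _ → -‿inverseʳ _ , -‿inverseʳ _)
            ; ⁻¹-cong = λ (p , q) → -‿cong p , -‿cong q
            }
          ; comm = λ _ _ → +-comm _ _ , +-comm _ _
          }
        ; *-cong = λ (p , q) (p′ , q′) →
            +-cong (*-cong p p′) (-‿cong (*-cong q q′)) , +-cong (*-cong p q′) (*-cong q p′)
        ; *-assoc = λ (x +i x′) (y +i y′) (z +i z′) →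
            assoc-re x x′ y y′ z z′ , assoc-im x x′ y y′ z z′
        ; *-identity = (λ (x +i x′) → identityˡ-re x x′ , identityˡ-im x x′)
                     , (λ z → ≋-trans (⊠-comm z _) (identityˡ-re (re z) (im z) , identityˡ-im (re z) (im z)))
        ; distrib = distribˡᶜ , λ x y z → ≋-trans (⊠-comm _ x)
            (≋-trans (distribˡᶜ x y z)
              (let (p , q) = ⊠-comm x y ; (p′ , q′) = ⊠-comm x z in +-cong p p′ , +-cong q q′))
        }
      ; *-comm = ⊠-comm
      }
    }

module ℝᴿ = CommutativeRing ℝ-ring

open Complexification ℝ-ring using (_+i_; re; im) renaming (Complex to ℂ; complexRing to ℂ-ring) public

module ℂᴿ = CommutativeRing ℂ-ring

open MonoidSum ℂᴿ.+-monoid using (sum)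

-- ∣ z ∣ = r, with ∣ z ∣ the nonnegative square root of (re z)² + (im z)².
HasModulus : ℂ → ℝ → Set
HasModulus z r = ℝᴿ.0# ≤ᵣ r × r ℝᴿ.* r ℝᴿ.≈ re z ℝᴿ.* re z ℝᴿ.+ im z ℝᴿ.* im z

Convergesℂ : (ℕ → ℂ) → ℂ → Set
Convergesℂ z w = Real.Converges (re ∘ z) (re w) × Real.Converges (im ∘ z) (im w)

HasSize : Setoid a ℓ → ℕ → Set (a ⊔ ℓ)
HasSize V n = Inverse V (≡.setoid (Fin n))

-- Matrices with rows and columns indexed by the elements of V.  The
-- enumeration fin serves only to sum over V and to decide equality; no
-- matrix below depends on its order.
module Matrices {V : Setoid a ℓ} {n : ℕ} (fin : HasSize V n) where

  open Setoid V renaming (Carrier to ∣V∣; _≈_ to _≈ⱽ_)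
  open Inverse fin using (to; from; to-cong; from-cong; strictlyInverseʳ)

  _≟_ : Decidable _≈ⱽ_
  x ≟ y = map′ injective to-cong (to x Fin.≟ to y)
    where
    injective : to x ≡ to y → x ≈ⱽ y
    injective eq = Setoid.trans V (Setoid.sym V (strictlyInverseʳ x))
                     (Setoid.trans V (from-cong eq) (strictlyInverseʳ y))

  Matrix : Set a
  Matrix = ∣V∣ → ∣V∣ → ℂ

  infix  4 _≈ᴹ_
  infixl 7 _⊗_
  infixr 7 _·_
  infixr 8 _^_

  _≈ᴹ_ : Rel Matrix a
  A ≈ᴹ B = ∀ v u → A v u ℂᴿ.≈ B v u

  indicator : {R : Rel ∣V∣ e} → Decidable R → Matrix
  indicator R? v u = if does (R? v u) then ℂᴿ.1# else ℂᴿ.0#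

  identity : Matrix
  identity = indicator _≟_

  _⊗_ : Matrix → Matrix → Matrix
  (A ⊗ B) v u = sum λ i → A v (from i) ℂᴿ.* B (from i) u

  _·_ : ℂ → Matrix → Matrix
  (z · A) v u = z ℂᴿ.* A v u

  _^_ : Matrix → ℕ → Matrix
  A ^ zero    = identity
  A ^ ℕ.suc k = A ⊗ A ^ k

  1/_! : ℕ → ℂ
  1/ k ! = fromℚ ((+ 1) ℚ./ (k !)) +i ℝᴿ.0#
    where instance _ = k ℕ.!≢0

  expSum : Matrix → ℕ → Matrix
  expSum A N v u = sum λ (k : Fin N) → 1/ toℕ k ! ℂᴿ.* (A ^ toℕ k) v u

  -- exp as a relation: M is the entrywise limit of the exponential series
  -- of A.  Such an M is unique up to ≈ᴹ.
  IsExp : Matrix → Matrix → Set a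
  IsExp A M = ∀ v u → Convergesℂ (λ N → expSum A N v u) (M v u)

  permutationMatrix : Inverse V V → Matrix
  permutationMatrix σ = indicator λ v u → v ≟ Inverse.to σ u

IsAbelian : Group c ℓ → Set (c ⊔ ℓ)
IsAbelian G = Commutative _≈_ _∙_ where open Group G

record Subgroup (G : Group c ℓ) p : Set (c ⊔ ℓ ⊔ suc p) where
  open Group G
  field
    member    : Pred Carrier p
    resp      : member Respects _≈_
    ε-closed  : ε ∈ member
    ∙-closed  : ∀ {x y} → x ∈ member → y ∈ member → x ∙ y ∈ member
    ⁻¹-closed : ∀ {x} → x ∈ member → x ⁻¹ ∈ member

  group : Group (c ⊔ p) ℓ
  group = record
    { Carrier = Σ Carrier member
    ; _≈_     = _≈_ on proj₁
    ; _∙_     = λ (x , x∈) (y , y∈) → x ∙ y , ∙-closed x∈ y∈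
    ; ε       = ε , ε-closed
    ; _⁻¹     = λ (x , x∈) → x ⁻¹ , ⁻¹-closed x∈
    ; isGroup = record
      { isMonoid = record
        { isSemigroup = record
          { isMagma = record
            { isEquivalence = record
              { refl = Group.refl G ; sym = sym ; trans = trans }
            ; ∙-cong = ∙-cong
            }
          ; assoc = λ _ _ _ → assoc _ _ _
          }
        ; identity = (λ _ → identityˡ _) , (λ _ → identityʳ _)
        }
      ; inverse = (λ _ → inverseˡ _) , (λ _ → inverseʳ _)
      ; ⁻¹-cong = ⁻¹-cong
      }
    }

  leftCosets : Setoid c p
  leftCosets = record
    { Carrier = Carrier
    ; _≈_     = λ x y → x ⁻¹ ∙ y ∈ member
    ; isEquivalence = record
      { refl  = λ {x} → resp (sym (inverseˡ x)) ε-closed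
      ; sym   = λ {x} {y} x~y → resp (flip-inverse x y) (⁻¹-closed x~y)
      ; trans = λ {x} {y} {z} x~y y~z → resp (telescope x y z) (∙-closed x~y y~z)
      }
    }
    where
    open GroupProperties G
    open import Relation.Binary.Reasoning.Setoid setoid
    flip-inverse : ∀ x y → (x ⁻¹ ∙ y) ⁻¹ ≈ y ⁻¹ ∙ x
    flip-inverse x y = trans (⁻¹-anti-homo-∙ _ _) (∙-congˡ (⁻¹-involutive x))
    telescope : ∀ x y z → (x ⁻¹ ∙ y) ∙ (y ⁻¹ ∙ z) ≈ x ⁻¹ ∙ z
    telescope x y z = begin
      (x ⁻¹ ∙ y) ∙ (y ⁻¹ ∙ z)  ≈⟨ assoc _ _ _ ⟩
      x ⁻¹ ∙ (y ∙ (y ⁻¹ ∙ z))  ≈⟨ ∙-congˡ (sym (assoc _ _ _)) ⟩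
      x ⁻¹ ∙ ((y ∙ y ⁻¹) ∙ z)  ≈⟨ ∙-congˡ (∙-congʳ (inverseʳ y)) ⟩
      x ⁻¹ ∙ (ε ∙ z)           ≈⟨ ∙-congˡ (identityˡ z) ⟩
      x ⁻¹ ∙ z                 ∎

HasOrder : {G : Group c ℓ} → Subgroup G p → ℕ → Set _
HasOrder H n = HasSize (Group.setoid (Subgroup.group H)) n

HasIndex : {G : Group c ℓ} → Subgroup G p → ℕ → Set (c ⊔ p)
HasIndex H n = HasSize (Subgroup.leftCosets H) n

module _ {G : Group c ℓ} where
  open Group G

  data Generated (P : Pred Carrier p) : Pred Carrier (c ⊔ ℓ ⊔ p) where
    gen   : ∀ {x} → x ∈ P → Generated P x
    unit  : Generated P ε
    mul   : ∀ {x y} → Generated P x → Generated P y → Generated P (x ∙ y)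
    inv   : ∀ {x} → Generated P x → Generated P (x ⁻¹)
    equal : ∀ {x y} → x ≈ y → Generated P x → Generated P y

  ⟨_⟩ : Pred Carrier p → Subgroup G (c ⊔ ℓ ⊔ p)
  ⟨ P ⟩ = record
    { member    = Generated P
    ; resp      = equal
    ; ε-closed  = unit
    ; ∙-closed  = mul
    ; ⁻¹-closed = inv
    }

_×ᴳ_ : Group a ℓ → Group b ℓ′ → Group (a ⊔ b) (ℓ ⊔ ℓ′)
_×ᴳ_ = DirectProduct.group

Perm : Setoid a ℓ → Set _
Perm V = Inverse V V

Sym : Setoid a ℓ → Group (a ⊔ ℓ) (a ⊔ ℓ)
Sym V = record
  { Carrier = Perm V
  ; _≈_     = λ σ π → ∀ x → to σ x ≈ to π x
  ; _∙_     = λ σ π → Comp.inverse π σ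
  ; ε       = Id.inverse V
  ; _⁻¹     = Symm.inverse
  ; isGroup = record
    { isMonoid = record
      { isSemigroup = record
        { isMagma = record
          { isEquivalence = record
            { refl  = λ _ → V.refl
            ; sym   = λ p x → V.sym (p x)
            ; trans = λ p q x → V.trans (p x) (q x)
            }
          ; ∙-cong = λ {σ} {σ′} {π} {π′} p q x → V.trans (to-cong σ (q x)) (p (to π′ x))
          }
        ; assoc = λ _ _ _ _ → V.refl
        }
      ; identity = (λ _ _ → V.refl) , (λ _ _ → V.refl)
      }
    ; inverse = (λ σ x → strictlyInverseʳ σ x) , (λ σ x → strictlyInverseˡ σ x)
    ; ⁻¹-cong = λ {σ} {π} p x → V.trans
        (from-cong σ (V.trans (V.sym (strictlyInverseˡ π x)) (V.sym (p (from π x)))))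
        (strictlyInverseʳ σ (from π x))
    }
  }
  where
  module V = Setoid V
  open V using (_≈_)
  open Inverse

infix 4 _≈ₚ_

_≈ₚ_ : {V : Setoid a ℓ} → Rel (Perm V) _
_≈ₚ_ {V = V} = Group._≈_ (Sym V)

module _ {V : Setoid a ℓ} where
  open Setoid V

  record IsRegular (K : Subgroup (Sym V) p) : Set (a ⊔ ℓ ⊔ p) where
    open Subgroup K using (member)
    field
      transitive        : ∀ x y → ∃ λ σ → σ ∈ member × Inverse.to σ x ≈ y
      trivialStabilizer : ∀ x {σ} → σ ∈ member → Inverse.to σ x ≈ x →
                          σ ≈ₚ Id.inverse V

module _ (G : Group c ℓ) where
  open Group G

  R : Carrier → Perm setoid
  R a = record
    { to        = _∙ a
    ; from      = _∙ a ⁻¹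
    ; to-cong   = ∙-congʳ
    ; from-cong = ∙-congʳ
    ; inverse   = (λ {x} {y} y≈ → trans (∙-congʳ y≈) (trans (assoc x _ _) (trans (∙-congˡ (inverseˡ a)) (identityʳ x))))
                , (λ {x} {y} y≈ → trans (∙-congʳ y≈) (trans (assoc x _ _) (trans (∙-congˡ (inverseʳ a)) (identityʳ x))))
    }

  L : Carrier → Perm setoid
  L a = record
    { to        = a ∙_
    ; from      = a ⁻¹ ∙_
    ; to-cong   = ∙-congˡ
    ; from-cong = ∙-congˡ
    ; inverse   = (λ {x} {y} y≈ → trans (∙-congˡ y≈) (trans (sym (assoc _ _ x)) (trans (∙-congʳ (inverseʳ a)) (identityˡ x))))
                , (λ {x} {y} y≈ → trans (∙-congˡ y≈) (trans (sym (assoc _ _ x)) (trans (∙-congʳ (inverseˡ a)) (identityˡ x))))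
    }

R[_] : {G : Group c ℓ} → Subgroup G p → Pred (Perm (Group.setoid G)) _
R[_] {G = G} H σ = ∃ λ h → h ∈ Subgroup.member H × σ ≈ₚ R G h

⟨R[_],L_⟩ : {G : Group c ℓ} → Subgroup G p → Group.Carrier G → Subgroup (Sym (Group.setoid G)) _
⟨R[_],L_⟩ {G = G} H s = ⟨ R[ H ] U.∪ (_≈ₚ L G s) ⟩

record Graph (V : Setoid a ℓ) e : Set (a ⊔ ℓ ⊔ suc e) where
  open Setoid V
  infix 4 _~_ _~?_
  field
    _~_    : Rel Carrier e
    ~-resp : _~_ Respects₂ _≈_
    ~-sym  : Symmetric _~_
    ~-irr  : Irreflexive _≈_ _~_
    _~?_   : Decidable _~_

_≅_ : {V : Setoid a ℓ} {W : Setoid b ℓ′} → Graph V e → Graph W p → Set _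
_≅_ {V = V} {W = W} X Y = Σ (Inverse V W) λ φ →
  ∀ u v → (u X.~ v) ⇔ (Inverse.to φ u Y.~ Inverse.to φ v)
  where
  module X = Graph X
  module Y = Graph Y

Aut : {V : Setoid a ℓ} → Graph V e → Subgroup (Sym V) (a ⊔ e)
Aut {V = V} X = record
  { member    = λ σ → ∀ u v → (u ~ v) ⇔ (to σ u ~ to σ v)
  ; resp      = λ {σ} {π} σ≈π f u v → mk⇔
      (λ p → resp (σ≈π u) (σ≈π v) (f u v .Equivalence.to p))
      (λ p → f u v .Equivalence.from (resp (sym (σ≈π u)) (sym (σ≈π v)) p))
  ; ε-closed  = λ u v → mk⇔ id id
  ; ∙-closed  = λ {σ} {π} f g u v → mk⇔
      (λ p → f _ _ .Equivalence.to (g u v .Equivalence.to p))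
      (λ p → g u v .Equivalence.from (f _ _ .Equivalence.from p))
  ; ⁻¹-closed = λ {σ} f u v → mk⇔
      (λ p → f _ _ .Equivalence.from (resp (sym (strictlyInverseˡ σ u)) (sym (strictlyInverseˡ σ v)) p))
      (λ p → resp (strictlyInverseˡ σ u) (strictlyInverseˡ σ v) (f _ _ .Equivalence.to p))
  }
  where
  open Graph X
  open Setoid V
  open Inverse
  resp : ∀ {u u′ v v′} → u ≈ u′ → v ≈ v′ → u ~ v → u′ ~ v′
  resp p q r = proj₁ ~-resp q (proj₂ ~-resp p r)

-- Classically every subset of a finite group is decidable; member? makes the
-- adjacency relation of Cay G S decidable, so that its 0/1 matrix is defined.
record ConnectionSet (G : Group c ℓ) s : Set (c ⊔ ℓ ⊔ suc s) where
  open Group G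
  field
    member        : Pred Carrier s
    resp          : member Respects _≈_
    member?       : U.Decidable member
    1∉            : ε ∉ member
    inverseClosed : ∀ {x} → x ∈ member → x ⁻¹ ∈ member

Cay : (G : Group c ℓ) → ConnectionSet G s → Graph (Group.setoid G) s
Cay G S = record
  { _~_    = λ g h → h ∙ g ⁻¹ ∈ member
  ; ~-resp = (λ h≈h′ → resp (∙-congʳ h≈h′)) , (λ g≈g′ → resp (∙-congˡ (⁻¹-cong g≈g′)))
  ; ~-sym  = λ {g} {h} p → resp (trans (⁻¹-anti-homo-∙ _ _) (∙-congʳ (⁻¹-involutive g))) (inverseClosed p)
  ; ~-irr  = λ {g} {h} g≈h p → 1∉ (resp (trans (∙-congʳ (sym g≈h)) (inverseʳ g)) p)
  ; _~?_   = λ g h → member? (h ∙ g ⁻¹)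
  }
  where
  open Group G
  open GroupProperties G
  open ConnectionSet S

IsCayleyGraphOf : {V : Setoid a ℓ} → Graph V e → Group b ℓ′ → Set _
IsCayleyGraphOf {e = e} X K = Σ (ConnectionSet K e) λ S′ → X ≅ Cay K S′

module _ {V : Setoid a ℓ} {n : ℕ} (fin : HasSize V n) (X : Graph V e) where
  open Setoid V
  open Graph X
  open Matrices fin

  adjacencyMatrix : Matrix
  adjacencyMatrix = indicator _~?_

  -- (ℝᴿ.0# +i t) is the complex number it, so this says U = exp(itA).
  IsTransitionMatrix : ℝ → Matrix → Set a
  IsTransitionMatrix t U = IsExp ((ℝᴿ.0# +i t) · adjacencyMatrix) U

  HasPSTAt : ℝ → Set (a ⊔ ℓ)
  HasPSTAt τ = ∃ λ U → IsTransitionMatrix τ U ×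
    ∃₂ λ u v → ¬ (u ≈ v) × HasModulus (U v u) ℝᴿ.1#

  -- This determines T when X has PST at time τ. That T then has order two
  -- and no fixed points, and is central in Aut X, are consequences and
  -- not part of the definition.
  IsPSTInvolutionAt : ℝ → Inverse V V → Set a
  IsPSTInvolutionAt τ T = ∃ λ U → IsTransitionMatrix τ U ×
    ∃ λ γ → U ≈ᴹ γ · permutationMatrix T

{-# OPTIONS --safe #-}
-- Write U = γP for the transition matrix, with P the permutation matrix of T;
-- perfect state transfer forces γ ≠ 0.  As a limit of polynomials in the symmetric
-- matrix A, U is symmetric and commutes with A, hence so does P: T is an involution
-- and an automorphism of X.  So if T = L s, then s² = 1 and S is invariant under
-- conjugation by s.  Since H has index 2, each x ∈ G is uniquely sᵏ a with k ∈ C₂ and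
-- a ∈ H, the elements of ⟨R(H), L s⟩ are the maps x ↦ sᵏ x a, and
-- (a , k) ↦ sᵏ a identifies X with Cay(H × C₂, {(a , k) : sᵏ a ∈ S}).
module Submission where

open import Defs
open import Level using (Level; _⊔_)
open import Data.Nat.Base using (ℕ)
open import Data.Product.Base using (_×_)
open import Relation.Unary using (_∉_; _⊆_)
open import Algebra.Bundles using (Group)

open import Algebra.Bundles using (CommutativeRing; CommutativeSemiring)
import Algebra.Properties.Group as GroupProperties
import Algebra.Properties.Semiring.Sum as Sum
import Algebra.Solver.Monoid as MonoidSolver
open import Algebra.Structures using (IsCommutativeRing)
open import Data.Bool.Base using (if_then_else_)
open import Data.Fin.Base as Fin using (Fin)
open import Data.Fin.Patterns using (0F; 1F)
import Data.Fin.Properties as Fin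
import Data.Nat.Base as ℕ
import Data.Nat.Properties as ℕ
open import Data.Parity.Base using (Parity; 0ℙ; 1ℙ) renaming (_+_ to _+ℙ_)
import Data.Parity.Properties as ℙ
open import Data.Product.Base using (∃; ∃₂; _,_; proj₁; proj₂)
open import Data.Rational.Base using (ℚ; 0ℚ; 1ℚ; ½)
import Data.Rational.Properties as ℚ
open import Data.Rational.Solver using (module +-*-Solver)
open import Data.Sum.Base using (inj₁; inj₂)
open import Function.Base using (_∘_)
open import Function.Bundles using (Inverse; Equivalence; _⇔_; mk⇔)
import Function.Construct.Identity as Identity
open import Relation.Binary using (Decidable; Rel; Setoid)
open import Relation.Binary.PropositionalEquality as ≡ using (_≡_; _≢_)
import Relation.Binary.Reasoning.Setoid as SetoidReasoning
open import Relation.Nullary using (¬_; contradiction; does; no; yes)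
open import Relation.Nullary.Decidable using (dec-false; dec-true)
open import Relation.Unary using (Pred; _∈_; _∪_)

-- The entries of `U` are complex numbers with no decidable equality, so facts about vertices are
-- drawn only from 0/1 entries: `γ * [R] ≈ γ * [Q]` with `γ ≉ 0` turns a proof of `R` into one of
-- `Q`, because `Q` is decidable. On the group side, `s` need not commute with `H`, and
-- `(a , k) ↦ sᵏ a` is in general not a homomorphism into `G`. Commutativity of the permutation
-- group comes from elsewhere: left translations commute with right translations, and only right
-- translations by the abelian `H` are used. Adjacency looks at `h g⁻¹`, so every right translation
-- is an automorphism, whereas `L s` being one says exactly that conjugation by `s` preserves `S`.
-- This invariance makes up for the missing homomorphism when adjacency is carried over to `H × C₂`.

private
  variable
    a b c ℓ ℓ′ e e′ h p : Level
    n m : ℕ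

-- Limits of real and complex sequences

module RealLimits where

  open import Data.Rational.Base using (∣_∣; _+_; _*_; _-_; -_; _<_; _≤_)
  open Real using (seq; Converges; _⊕_; close; below; mk≈)

  record Near (x y : ℝ) (ε : ℚ) : Set where
    constructor mkNear
    field
      eventually : ∃ λ N → ∀ n → N ℕ.≤ n → ∣ seq x n - seq y n ∣ < ε

  private
    open +-*-Solver

    halves : ∀ ε → ½ * ε + ½ * ε ≡ ε
    halves = solve 1 (λ ε → con ½ :* ε :+ con ½ :* ε := ε) ≡.refl

    0<½* : ∀ {ε} → 0ℚ < ε → 0ℚ < ½ * ε
    0<½* {ε} 0<ε = ≡.subst (_< ½ * ε) (ℚ.*-zeroʳ ½) (ℚ.*-monoʳ-<-pos ½ 0<ε)

    split : ∀ x y z → x ≡ y + z → ∣ x ∣ ≤ ∣ y ∣ + ∣ z ∣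
    split _ y z ≡.refl = ℚ.∣p+q∣≤∣p∣+∣q∣ y z

  near-sym : ∀ {x y ε} → Near x y ε → Near y x ε
  near-sym {x} {y} {ε} (mkNear (N , f)) = mkNear
    (N , λ n N≤n → ≡.subst (_< ε) (swap (seq x n) (seq y n)) (f n N≤n))
    where
    swap : ∀ p q → ∣ p - q ∣ ≡ ∣ q - p ∣
    swap p q = ≡.trans (≡.sym (ℚ.∣-p∣≡∣p∣ (p - q)))
      (≡.cong ∣_∣ (solve 2 (λ p q → :- (p :- q) := q :- p) ≡.refl p q))

  near-trans : ∀ {x y z ε δ} → Near x y ε → Near y z δ → Near x z (ε + δ)
  near-trans {x} {y} {z} (mkNear (M , f)) (mkNear (N , g)) = mkNear (M ℕ.⊔ N , λ n le → ℚ.≤-<-trans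
    (split (seq x n - seq z n) (seq x n - seq y n) (seq y n - seq z n)
      (solve 3 (λ x y z → x :- z := (x :- y) :+ (y :- z)) ≡.refl (seq x n) (seq y n) (seq z n)))
    (ℚ.+-mono-< (f n (ℕ.m⊔n≤o⇒m≤o M N le)) (g n (ℕ.m⊔n≤o⇒n≤o M N le))))

  near-⊕ : ∀ {x x′ y y′ ε δ} → Near x x′ ε → Near y y′ δ → Near (x ⊕ y) (x′ ⊕ y′) (ε + δ)
  near-⊕ {x} {x′} {y} {y′} (mkNear (M , f)) (mkNear (N , g)) = mkNear (M ℕ.⊔ N , λ n le → ℚ.≤-<-trans
    (split ((seq x n + seq y n) - (seq x′ n + seq y′ n)) (seq x n - seq x′ n) (seq y n - seq y′ n)
      (solve 4 (λ x x′ y y′ → (x :+ y) :- (x′ :+ y′) := (x :- x′) :+ (y :- y′)) ≡.refl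
        (seq x n) (seq x′ n) (seq y n) (seq y′ n)))
    (ℚ.+-mono-< (f n (ℕ.m⊔n≤o⇒m≤o M N le)) (g n (ℕ.m⊔n≤o⇒n≤o M N le))))

  near-halves : ∀ {x y z ε} → Near x y (½ * ε) → Near y z (½ * ε) → Near x z ε
  near-halves {x} {z = z} {ε} p q = ≡.subst (Near x z) (halves ε) (near-trans p q)

  -- Converges bounds a difference by ≤ᵣ; unfolding that to strict rational
  -- inequalities makes limits a matter of the triangle inequality in ℚ.
  record Limit (x : ℕ → ℝ) (y : ℝ) : Set where
    constructor mkLimit
    field
      approx : ∀ ε → 0ℚ < ε → ∃ λ N → ∀ n → N ℕ.≤ n → Near (x n) y ε

  open Limit

  -- Half of `ε` goes to the convergence, the other half to the slack built into `≤ᵣ`.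
  converges⇒limit : ∀ {x y} → Converges x y → Limit x y
  converges⇒limit {x} {y} conv = mkLimit λ ε 0<ε →
    let (N , f) = conv (½ * ε) (0<½* 0<ε) in
    N , λ n N≤n → let (M , g) = below (f n N≤n) (½ * ε) (0<½* 0<ε) in
      mkNear (M , λ m M≤m → ≡.subst (∣ seq (x n) m - seq y m ∣ <_) (halves ε) (g m M≤m))

  limit-resp-≈ : ∀ {x x′ y} → (∀ n → x n ℝᴿ.≈ x′ n) → Limit x y → Limit x′ y
  limit-resp-≈ {x} {x′} {y} x≈x′ lim = mkLimit λ ε 0<ε →
    let (N , f) = approx lim (½ * ε) (0<½* 0<ε) in
    N , λ n N≤n → near-halves
      (near-sym {x n} {x′ n} (mkNear (close (x≈x′ n) (½ * ε) (0<½* 0<ε)))) (f n N≤n)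

  limit-resp-≈ʳ : ∀ {x y y′} → y ℝᴿ.≈ y′ → Limit x y → Limit x y′
  limit-resp-≈ʳ y≈y′ lim = mkLimit λ ε 0<ε →
    let (N , f) = approx lim (½ * ε) (0<½* 0<ε) in
    N , λ n N≤n → near-halves (f n N≤n) (mkNear (close y≈y′ (½ * ε) (0<½* 0<ε)))

  limit-unique : ∀ {x y y′} → Limit x y → Limit x y′ → y ℝᴿ.≈ y′
  limit-unique lim lim′ = mk≈ λ ε 0<ε →
    let (M , f) = approx lim (½ * ε) (0<½* 0<ε)
        (N , g) = approx lim′ (½ * ε) (0<½* 0<ε)
    in Near.eventually (near-halves (near-sym (f (M ℕ.⊔ N) (ℕ.m≤m⊔n M N))) (g (M ℕ.⊔ N) (ℕ.m≤n⊔m M N)))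

  limit-⊕ : ∀ {x x′ y y′} → Limit x y → Limit x′ y′ → Limit (λ n → x n ⊕ x′ n) (y ⊕ y′)
  limit-⊕ {x} {x′} {y} {y′} lim lim′ = mkLimit λ ε 0<ε →
    let (M , f) = approx lim (½ * ε) (0<½* 0<ε)
        (N , g) = approx lim′ (½ * ε) (0<½* 0<ε)
    in M ℕ.⊔ N , λ n le → ≡.subst (Near (x n ⊕ x′ n) (y ⊕ y′)) (halves ε)
         (near-⊕ (f n (ℕ.m⊔n≤o⇒m≤o M N le)) (g n (ℕ.m⊔n≤o⇒n≤o M N le)))

  limit-const : ∀ {x} → Limit (λ _ → x) x
  limit-const {x} = mkLimit λ ε 0<ε → 0 , λ _ _ → mkNear (close (ℝᴿ.refl {x}) ε 0<ε)

  record Limitℂ (z : ℕ → ℂ) (w : ℂ) : Set where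
    constructor mkLimitℂ
    field
      re-limit : Limit (re ∘ z) (re w)
      im-limit : Limit (im ∘ z) (im w)

  convergesℂ⇒limitℂ : ∀ {z w} → Convergesℂ z w → Limitℂ z w
  convergesℂ⇒limitℂ {z} {w} (p , q) =
    mkLimitℂ (converges⇒limit {re ∘ z} {re w} p) (converges⇒limit {im ∘ z} {im w} q)

  limitℂ-resp-≈ : ∀ {z z′ w} → (∀ n → z n ℂᴿ.≈ z′ n) → Limitℂ z w → Limitℂ z′ w
  limitℂ-resp-≈ z≈z′ (mkLimitℂ p q) =
    mkLimitℂ (limit-resp-≈ (proj₁ ∘ z≈z′) p) (limit-resp-≈ (proj₂ ∘ z≈z′) q)

  limitℂ-resp-≈ʳ : ∀ {z w w′} → w ℂᴿ.≈ w′ → Limitℂ z w → Limitℂ z w′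
  limitℂ-resp-≈ʳ (p , q) (mkLimitℂ p′ q′) = mkLimitℂ (limit-resp-≈ʳ p p′) (limit-resp-≈ʳ q q′)

  limitℂ-unique : ∀ {z w w′} → Limitℂ z w → Limitℂ z w′ → w ℂᴿ.≈ w′
  limitℂ-unique (mkLimitℂ p q) (mkLimitℂ p′ q′) = limit-unique p p′ , limit-unique q q′

  limitℂ-const : ∀ {w} → Limitℂ (λ _ → w) w
  limitℂ-const = mkLimitℂ limit-const limit-const

  1≉0 : ¬ (ℝᴿ.1# ℝᴿ.≈ ℝᴿ.0#)
  -- At `ε = 1` closeness of the constant sequences would read `1 < 1`.
  1≉0 1≈0 = let (N , f) = close {ℝᴿ.1#} {ℝᴿ.0#} 1≈0 1ℚ (ℚ.positive⁻¹ 1ℚ) in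
    ℚ.<-irrefl {1ℚ} ≡.refl (f N ℕ.≤-refl)

open RealLimits

-- Finite sums and matrices over a commutative semiring

module FiniteSums (S : CommutativeSemiring b ℓ′) where
  open CommutativeSemiring S
  open Sum semiring public using (sum)
  open Sum semiring hiding (sum)
  open SetoidReasoning setoid

  sum-cong : {f g : Fin n → Carrier} → (∀ i → f i ≈ g i) → sum f ≈ sum g
  sum-cong = sum-cong-≋

  sum-zero : {f : Fin n → Carrier} → (∀ i → f i ≈ 0#) → sum f ≈ 0#
  sum-zero {n} f≈0 = trans (sum-cong f≈0) (sum-replicate-zero n)

  sum-single : (f : Fin n → Carrier) (j : Fin n) → (∀ i → i ≢ j → f i ≈ 0#) → sum f ≈ f j
  sum-single f Fin.zero    f≈0 =
    trans (+-congˡ (sum-zero λ i → f≈0 (Fin.suc i) λ ())) (+-identityʳ _)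
  sum-single f (Fin.suc j) f≈0 =
    trans (+-cong (f≈0 Fin.zero λ ()) (sum-single (f ∘ Fin.suc) j λ i i≢j → f≈0 (Fin.suc i) (i≢j ∘ Fin.suc-injective)))
      (+-identityˡ _)

  -- An interchange of two finite sums. It serves both as associativity of the matrix product and as
  -- right multiplication of a linear combination of matrices.
  sum-assoc : (x : Fin n → Carrier) (y : Fin n → Fin m → Carrier) (z : Fin m → Carrier) →
              sum (λ j → sum (λ i → x i * y i j) * z j) ≈ sum (λ i → x i * sum (λ j → y i j * z j))
  sum-assoc {n} {m} x y z = begin
    sum (λ j → sum (λ i → x i * y i j) * z j)    ≈⟨ sum-cong (λ j → *-distribʳ-sum (z j) λ i → x i * y i j) ⟩
    sum (λ j → sum (λ i → x i * y i j * z j))    ≈⟨ ∑-comm (λ j i → x i * y i j * z j) ⟩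
    sum (λ i → sum (λ j → x i * y i j * z j))    ≈⟨ sum-cong (λ i → sum-cong λ j → *-assoc (x i) (y i j) (z j)) ⟩
    sum (λ i → sum (λ j → x i * (y i j * z j)))  ≈⟨ sum-cong (λ i → *-distribˡ-sum (x i) λ j → y i j * z j) ⟨
    sum (λ i → x i * sum (λ j → y i j * z j))    ∎

  sum-*-comm : (x y : Fin n → Carrier) → sum (λ i → x i * y i) ≈ sum (λ i → y i * x i)
  sum-*-comm x y = sum-cong λ i → *-comm (x i) (y i)

  sum-scaleʳ : ∀ c (x y : Fin n → Carrier) → sum (λ i → x i * (c * y i)) ≈ c * sum (λ i → x i * y i)
  sum-scaleʳ c x y = trans (sum-cong λ i → swap (x i) c (y i)) (sym (*-distribˡ-sum c λ i → x i * y i))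
    where
    swap : ∀ u v w → u * (v * w) ≈ v * (u * w)
    swap u v w = trans (sym (*-assoc u v w)) (trans (*-congʳ (*-comm u v)) (*-assoc v u w))

  sum-scaleˡ : ∀ c (x y : Fin n → Carrier) → sum (λ i → (c * x i) * y i) ≈ c * sum (λ i → x i * y i)
  sum-scaleˡ c x y = trans (sum-cong λ i → *-assoc c (x i) (y i)) (sym (*-distribˡ-sum c λ i → x i * y i))

  sum-combination : (c : Fin m → Carrier) (x : Fin n → Carrier) (y : Fin m → Fin n → Carrier) →
    sum (λ i → x i * sum (λ k → c k * y k i)) ≈ sum (λ k → c k * sum (λ i → x i * y k i))
  sum-combination c x y = begin
    sum (λ i → x i * sum (λ k → c k * y k i))  ≈⟨ sum-*-comm x (λ i → sum λ k → c k * y k i) ⟩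
    sum (λ i → sum (λ k → c k * y k i) * x i)  ≈⟨ sum-assoc c y x ⟩
    sum (λ k → c k * sum (λ i → y k i * x i))  ≈⟨ sum-cong (λ k → *-congˡ (sum-*-comm (y k) x)) ⟩
    sum (λ k → c k * sum (λ i → x i * y k i))  ∎

-- Defs.Matrices over an arbitrary commutative semiring: over ℂ itself, conversion
-- checking would unfold products into Cauchy sequences.  For the same reason, terms
-- compared with those of Defs are spelled exactly as there (Inverse.from fin,
-- CommutativeRing.1# ℝ-ring), and not by a name opened in this file.
module MatrixAlgebra (S : CommutativeSemiring b ℓ′) {V : Setoid a ℓ} {n : ℕ} (fin : HasSize V n) where

  module S = CommutativeSemiring S
  open S using (_≈_; _*_; 0#; 1#)
  open FiniteSums S
  open Setoid V using () renaming (Carrier to ∣V∣; _≈_ to _≈ⱽ_)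
  module V = Setoid V
  open Inverse fin using (to; from; to-cong; from-cong; strictlyInverseʳ; strictlyInverseˡ)
  open Matrices fin using (_≟_)

  infix  4 _≈ᴹ_
  infixl 7 _⊗_
  infixr 7 _·_

  Matrix : Set _
  Matrix = ∣V∣ → ∣V∣ → S.Carrier

  _≈ᴹ_ : Rel Matrix _
  A ≈ᴹ B = ∀ v u → A v u ≈ B v u

  indicator : {R : Rel ∣V∣ e} → Decidable R → Matrix
  indicator R? v u = if does (R? v u) then 1# else 0#

  identity : Matrix
  identity = indicator (Matrices._≟_ fin)

  _⊗_ : Matrix → Matrix → Matrix
  (A ⊗ B) v u = sum λ i → A v (Inverse.from fin i) * B (Inverse.from fin i) u

  _·_ : S.Carrier → Matrix → Matrix
  (z · A) v u = z * A v u

  permutationMatrix : Perm V → Matrix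
  permutationMatrix σ = indicator λ v u → Matrices._≟_ fin v (Inverse.to σ u)

  Congruent : Matrix → Set _
  Congruent A = ∀ {v v′ u u′} → v ≈ⱽ v′ → u ≈ⱽ u′ → A v u ≈ A v′ u′

  Symmetricᴹ : Matrix → Set _
  Symmetricᴹ A = ∀ v u → A v u ≈ A u v

  Commute : Matrix → Matrix → Set _
  Commute A B = A ⊗ B ≈ᴹ B ⊗ A

  -- Powers are given by their recursion alone, so that those already defined over ℂ can be plugged
  -- in as they are.
  record IsPowers (B : Matrix) (pow : ℕ → Matrix) : Set (a ⊔ b ⊔ ℓ′) where
    field
      pow-zero : pow 0 ≈ᴹ identity
      pow-suc  : ∀ k → pow (ℕ.suc k) ≈ᴹ B ⊗ pow k

  module _ {R : Rel ∣V∣ e} (R? : Decidable R) where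

    indicator-true : ∀ {v u} → R v u → indicator R? v u ≈ 1#
    indicator-true {v} {u} r = S.reflexive
      (≡.cong (λ b → if b then 1# else 0#) (dec-true (R? v u) r))

    indicator-false : ∀ {v u} → ¬ R v u → indicator R? v u ≈ 0#
    indicator-false {v} {u} ¬r = S.reflexive
      (≡.cong (λ b → if b then 1# else 0#) (dec-false (R? v u) ¬r))

  indicator-cong : {R : Rel ∣V∣ e} {Q : Rel ∣V∣ e′} (R? : Decidable R) (Q? : Decidable Q) →
    ∀ {v u v′ u′} → (R v u → Q v′ u′) → (Q v′ u′ → R v u) →
    indicator R? v u ≈ indicator Q? v′ u′
  indicator-cong R? Q? {v} {u} {v′} {u′} f g with Q? v′ u′
  ... | yes q = indicator-true R? (g q)
  ... | no ¬q = indicator-false R? (¬q ∘ f)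

  -- If `R` held and `Q` failed, the equation would read `γ ≈ 0`.
  scaled-indicator-injective : {R : Rel ∣V∣ e} {Q : Rel ∣V∣ e′} (R? : Decidable R) (Q? : Decidable Q) →
    ∀ {γ v u v′ u′} → ¬ γ ≈ 0# → γ * indicator R? v u ≈ γ * indicator Q? v′ u′ → R v u → Q v′ u′
  scaled-indicator-injective R? Q? {γ} {v} {u} {v′} {u′} γ≉0 eq r with Q? v′ u′
  ... | yes q = q
  ... | no ¬q = contradiction γ≈0 γ≉0
    where
    open SetoidReasoning S.setoid
    γ≈0 : γ ≈ 0#
    γ≈0 = begin
      γ                     ≈⟨ S.*-identityʳ γ ⟨
      γ * 1#                ≈⟨ S.*-congˡ {γ} (indicator-true R? r) ⟨
      γ * indicator R? v u  ≈⟨ eq ⟩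
      γ * 0#                ≈⟨ S.zeroʳ γ ⟩
      0#                    ∎

  ⊗-cong : ∀ {A A′ B B′} → A ≈ᴹ A′ → B ≈ᴹ B′ → A ⊗ B ≈ᴹ A′ ⊗ B′
  ⊗-cong A≈ B≈ v u = sum-cong λ i → S.*-cong (A≈ v (from i)) (B≈ (from i) u)

  ⊗-assoc : ∀ A B C → (A ⊗ B) ⊗ C ≈ᴹ A ⊗ (B ⊗ C)
  ⊗-assoc A B C v u =
    sum-assoc (λ i → A v (from i)) (λ i j → B (from i) (from j)) (λ j → C (from j) u)

  ⊗-·ʳ : ∀ z A B → A ⊗ (z · B) ≈ᴹ z · (A ⊗ B)
  ⊗-·ʳ z A B v u = sum-scaleʳ z (λ i → A v (from i)) (λ i → B (from i) u)

  ⊗-·ˡ : ∀ z A B → (z · A) ⊗ B ≈ᴹ z · (A ⊗ B)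
  ⊗-·ˡ z A B v u = sum-scaleˡ z (λ i → A v (from i)) (λ i → B (from i) u)

  ·-zeroˡ : ∀ {z} → z ≈ 0# → ∀ A v u → (z · A) v u ≈ 0#
  ·-zeroˡ z≈0 A v u = S.trans (S.*-congʳ z≈0) (S.zeroˡ (A v u))

  -- Column `u` of the permutation matrix has its only 1 in row `σ u`. Congruence of `A` is what
  -- replaces `from (to w)` by `w`.
  ⊗-permutationMatrix : ∀ {A} → Congruent A → (σ : Perm V) →
    ∀ v u → (A ⊗ permutationMatrix σ) v u ≈ A v (Inverse.to σ u)
  ⊗-permutationMatrix {A} A-cong σ v u = begin
    (A ⊗ P) v u                            ≈⟨ sum-single term (to w) off ⟩
    A v (from (to w)) * P (from (to w)) u  ≈⟨ S.*-cong
      (A-cong V.refl (strictlyInverseʳ w)) (indicator-true P? (strictlyInverseʳ w)) ⟩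
    A v w * 1#                             ≈⟨ S.*-identityʳ (A v w) ⟩
    A v w                                  ∎
    where
    open SetoidReasoning S.setoid
    P = permutationMatrix σ
    P? : Decidable λ v u → v ≈ⱽ Inverse.to σ u
    P? v u = v ≟ Inverse.to σ u
    w = Inverse.to σ u
    term : Fin n → S.Carrier
    term i = A v (from i) * P (from i) u
    off : ∀ i → i ≢ to w → term i ≈ 0#
    off i i≢ = S.trans
      (S.*-congˡ {A v (from i)} (indicator-false P? λ eq →
        i≢ (≡.trans (≡.sym (strictlyInverseˡ i)) (to-cong eq))))
      (S.zeroʳ (A v (from i)))

  -- Row `v` has its only 1 in column `σ⁻¹ v`.
  permutationMatrix-⊗ : ∀ {A} → Congruent A → (σ : Perm V) →
    ∀ v u → (permutationMatrix σ ⊗ A) v u ≈ A (Inverse.from σ v) u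
  permutationMatrix-⊗ {A} A-cong σ v u = begin
    (P ⊗ A) v u                            ≈⟨ sum-single term (to w) off ⟩
    P v (from (to w)) * A (from (to w)) u  ≈⟨ S.*-cong
      (indicator-true P? (V.trans (V.sym (Inverse.strictlyInverseˡ σ v))
        (Inverse.to-cong σ (V.sym (strictlyInverseʳ w)))))
      (A-cong (strictlyInverseʳ w) V.refl) ⟩
    1# * A w u                             ≈⟨ S.*-identityˡ (A w u) ⟩
    A w u                                  ∎
    where
    open SetoidReasoning S.setoid
    P = permutationMatrix σ
    P? : Decidable λ v u → v ≈ⱽ Inverse.to σ u
    P? v u = v ≟ Inverse.to σ u
    w = Inverse.from σ v
    term : Fin n → S.Carrier
    term i = P v (from i) * A (from i) u
    off : ∀ i → i ≢ to w → term i ≈ 0#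
    off i i≢ = S.trans
      (S.*-congʳ {A (from i) u} (indicator-false P? λ eq →
        i≢ (≡.trans (≡.sym (strictlyInverseˡ i)) (to-cong
          (V.trans (V.sym (Inverse.strictlyInverseʳ σ (from i))) (Inverse.from-cong σ (V.sym eq)))))))
      (S.zeroˡ (A (from i) u))

  commute-· : ∀ z A → Commute A (z · A)
  commute-· z A v u = S.trans (⊗-·ʳ z A A v u) (S.sym (⊗-·ˡ z A A v u))

  -- The identity matrix is the permutation matrix of the identity, so both products collapse to
  -- `A`.
  commute-identity : ∀ {A} → Congruent A → Commute A identity
  commute-identity A-cong v u = S.trans
    (⊗-permutationMatrix A-cong (Identity.inverse V) v u)
    (S.sym (permutationMatrix-⊗ A-cong (Identity.inverse V) v u))

  ≈ᴹ-refl : ∀ {A} → A ≈ᴹ A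
  ≈ᴹ-refl _ _ = S.refl

  module Powers {B : Matrix} {pow : ℕ → Matrix} (isPowers : IsPowers B pow) where
    open IsPowers isPowers
    open SetoidReasoning S.setoid

    commute-pow : ∀ {A} → Congruent A → Commute A B → ∀ k → Commute A (pow k)
    commute-pow {A} A-cong AB ℕ.zero    v u = begin
      (A ⊗ pow 0) v u     ≈⟨ ⊗-cong (≈ᴹ-refl {A}) pow-zero v u ⟩
      (A ⊗ identity) v u  ≈⟨ commute-identity A-cong v u ⟩
      (identity ⊗ A) v u  ≈⟨ ⊗-cong pow-zero (≈ᴹ-refl {A}) v u ⟨
      (pow 0 ⊗ A) v u     ∎
    commute-pow {A} A-cong AB (ℕ.suc k) v u = begin
      (A ⊗ pow (ℕ.suc k)) v u  ≈⟨ ⊗-cong (≈ᴹ-refl {A}) (pow-suc k) v u ⟩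
      (A ⊗ (B ⊗ pow k)) v u    ≈⟨ ⊗-assoc A B (pow k) v u ⟨
      ((A ⊗ B) ⊗ pow k) v u    ≈⟨ ⊗-cong AB (≈ᴹ-refl {pow k}) v u ⟩
      ((B ⊗ A) ⊗ pow k) v u    ≈⟨ ⊗-assoc B A (pow k) v u ⟩
      (B ⊗ (A ⊗ pow k)) v u    ≈⟨ ⊗-cong (≈ᴹ-refl {B}) (commute-pow A-cong AB k) v u ⟩
      (B ⊗ (pow k ⊗ A)) v u    ≈⟨ ⊗-assoc B (pow k) A v u ⟨
      ((B ⊗ pow k) ⊗ A) v u    ≈⟨ ⊗-cong (pow-suc k) (≈ᴹ-refl {A}) v u ⟨
      (pow (ℕ.suc k) ⊗ A) v u  ∎

    -- Transposing `B ⊗ Bᵏ` reverses the factors; they are put back in order because `B` commutes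
    -- with its own powers.
    symmetric-pow : Congruent B → Symmetricᴹ B → ∀ k → Symmetricᴹ (pow k)
    symmetric-pow B-cong B-sym ℕ.zero    v u = begin
      pow 0 v u     ≈⟨ pow-zero v u ⟩
      identity v u  ≈⟨ indicator-cong _≟_ _≟_ V.sym V.sym ⟩
      identity u v  ≈⟨ pow-zero u v ⟨
      pow 0 u v     ∎
    symmetric-pow B-cong B-sym (ℕ.suc k) v u = begin
      pow (ℕ.suc k) v u   ≈⟨ pow-suc k v u ⟩
      (B ⊗ pow k) v u     ≈⟨ sum-*-comm (λ i → B v (from i)) (λ i → pow k (from i) u) ⟩
      sum (λ i → pow k (from i) u * B v (from i))
        ≈⟨ sum-cong (λ i → S.*-cong (symmetric-pow B-cong B-sym k (from i) u) (B-sym v (from i))) ⟩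
      (pow k ⊗ B) u v     ≈⟨ commute-pow B-cong (λ _ _ → S.refl) k u v ⟨
      (B ⊗ pow k) u v     ≈⟨ pow-suc k u v ⟨
      pow (ℕ.suc k) u v   ∎

    partialSum : (ℕ → S.Carrier) → ℕ → Matrix
    partialSum c N v u = sum λ (k : Fin N) → c (Fin.toℕ k) * pow (Fin.toℕ k) v u

    commute-partialSum : ∀ {A} → Congruent A → Commute A B → ∀ c N → Commute A (partialSum c N)
    commute-partialSum {A} A-cong AB c N v u = begin
      (A ⊗ partialSum c N) v u
        ≈⟨ sum-combination c′ (λ i → A v (from i)) (λ k i → pow (Fin.toℕ k) (from i) u) ⟩
      sum (λ k → c′ k * (A ⊗ pow (Fin.toℕ k)) v u)
        ≈⟨ sum-cong {n = N} (λ k → S.*-congˡ {c′ k} (commute-pow A-cong AB (Fin.toℕ k) v u)) ⟩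
      sum (λ k → c′ k * (pow (Fin.toℕ k) ⊗ A) v u)
        ≈⟨ sum-assoc c′ (λ k i → pow (Fin.toℕ k) v (from i)) (λ i → A (from i) u) ⟨
      (partialSum c N ⊗ A) v u ∎
      where
      c′ : Fin N → S.Carrier
      c′ k = c (Fin.toℕ k)

    symmetric-partialSum : Congruent B → Symmetricᴹ B → ∀ c N → Symmetricᴹ (partialSum c N)
    symmetric-partialSum B-cong B-sym c N v u = sum-cong {n = N} λ k →
      S.*-congˡ {c (Fin.toℕ k)} (symmetric-pow B-cong B-sym (Fin.toℕ k) v u)

-- Symmetry and commutation in the limit, and their consequences for the involution

record IsLimit (S : CommutativeSemiring b ℓ′)
  (_⟶_ : (ℕ → CommutativeSemiring.Carrier S) → CommutativeSemiring.Carrier S → Set p) : Set (b ⊔ ℓ′ ⊔ p) where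
  open CommutativeSemiring S
  field
    resp   : ∀ {x y z} → (∀ n → x n ≈ y n) → x ⟶ z → y ⟶ z
    respʳ  : ∀ {x y z} → y ≈ z → x ⟶ y → x ⟶ z
    unique : ∀ {x y z} → x ⟶ y → x ⟶ z → y ≈ z
    const  : ∀ {x} → (λ _ → x) ⟶ x
    add    : ∀ {x y z w} → x ⟶ z → y ⟶ w → (λ n → x n + y n) ⟶ (z + w)

module PerfectStateTransfer (S : CommutativeSemiring b ℓ′)
  {_⟶_ : (ℕ → CommutativeSemiring.Carrier S) → CommutativeSemiring.Carrier S → Set p}
  (isLimit : IsLimit S _⟶_)
  {V : Setoid a ℓ} {n : ℕ} (fin : HasSize V n) (X : Graph V e)
  where

  open MatrixAlgebra S fin
  open S using (_≈_; _*_; 0#; 1#)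
  open FiniteSums S
  open IsLimit isLimit
  open Graph X
  open Setoid V using () renaming (Carrier to ∣V∣; _≈_ to _≈ⱽ_)
  open Inverse fin using (from)
  open Matrices fin using (_≟_)

  A : Matrix
  A = indicator (Graph._~?_ X)

  ~-cong : ∀ {v v′ u u′} → v ≈ⱽ v′ → u ≈ⱽ u′ → v ~ u → v′ ~ u′
  ~-cong v≈ u≈ r = proj₁ ~-resp u≈ (proj₂ ~-resp v≈ r)

  A-cong : Congruent A
  A-cong v≈ u≈ = indicator-cong _~?_ _~?_ (~-cong v≈ u≈) (~-cong (V.sym v≈) (V.sym u≈))

  limit-sum : ∀ {m} {x : ℕ → Fin m → S.Carrier} {y : Fin m → S.Carrier} →
              (∀ i → (λ N → x N i) ⟶ y i) → (λ N → sum (x N)) ⟶ sum y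
  limit-sum {ℕ.zero}  x⟶y = const
  limit-sum {ℕ.suc m} x⟶y = add (x⟶y Fin.zero) (limit-sum (x⟶y ∘ Fin.suc))

  -- The factor is 1 or 0, so the sequence is `x` or constantly 0. This stands in for a product rule
  -- for limits.
  limit-indicator-* : ∀ v u {x y} → x ⟶ y → (λ N → A v u * x N) ⟶ (A v u * y)
  limit-indicator-* v u x⟶y with v ~? u
  ... | yes _ = respʳ (S.sym (S.*-identityˡ _)) (resp (λ N → S.sym (S.*-identityˡ _)) x⟶y)
  ... | no  _ = respʳ (S.sym (S.zeroˡ _)) (resp (λ N → S.sym (S.zeroˡ _)) const)

  -- B, D and P will be the matrices it·A, A and P of Defs.  Passing them separately from
  -- A and σ keeps the conversions needed for that to one product each.
  module _ {z : S.Carrier} {B D : Matrix} (B≈zD : B ≈ᴹ z · D) (D≈A : D ≈ᴹ A)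
    {pow : ℕ → Matrix} (isPowers : IsPowers B pow) (c : ℕ → S.Carrier)
    {U : Matrix} (exp : ∀ v u → (λ N → Powers.partialSum isPowers c N v u) ⟶ U v u)
    {σ : Perm V} {γ : S.Carrier} (γ≉0 : ¬ γ ≈ 0#)
    {P : Matrix} (U≈γP′ : U ≈ᴹ γ · P) (P′≈P : P ≈ᴹ permutationMatrix σ) where

    open Powers isPowers
    open SetoidReasoning S.setoid
    private
      module σ = Inverse σ
      P? : Decidable λ v u → v ≈ⱽ σ.to u
      P? v u = v ≟ σ.to u

    B≈zA : B ≈ᴹ z · A
    B≈zA v u = S.trans (B≈zD v u) (S.*-congˡ (D≈A v u))

    U≈γP : U ≈ᴹ γ · permutationMatrix σ
    U≈γP v u = S.trans (U≈γP′ v u) (S.*-congˡ (P′≈P v u))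

    B-cong : Congruent B
    B-cong {v} {v′} {u} {u′} v≈ u≈ =
      S.trans (B≈zA v u) (S.trans (S.*-congˡ (A-cong v≈ u≈)) (S.sym (B≈zA v′ u′)))

    B-sym : Symmetricᴹ B
    B-sym v u =
      S.trans (B≈zA v u) (S.trans (S.*-congˡ (indicator-cong _~?_ _~?_ ~-sym ~-sym)) (S.sym (B≈zA u v)))

    A-commutes-B : Commute A B
    A-commutes-B v u = begin
      (A ⊗ B) v u        ≈⟨ ⊗-cong (≈ᴹ-refl {A}) B≈zA v u ⟩
      (A ⊗ (z · A)) v u  ≈⟨ commute-· z A v u ⟩
      ((z · A) ⊗ A) v u  ≈⟨ ⊗-cong B≈zA (≈ᴹ-refl {A}) v u ⟨
      (B ⊗ A) v u        ∎

    U-symmetric : Symmetricᴹ U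
    U-symmetric v u = unique (exp v u)
      (resp (λ N → symmetric-partialSum B-cong B-sym c N u v) (exp u v))

    -- Both products are limits of the single sequence of products of `A` with the partial sums, by
    -- finite additivity of limits.
    U-commutes : Commute A U
    U-commutes v u = unique
      (limit-sum λ i → limit-indicator-* v (from i) (exp (from i) u))
      (resp (λ N → S.sym (commute-partialSum A-cong A-commutes-B c N v u))
        -- In `U ⊗ A` the 0/1 factor stands on the right; the factors are exchanged, in the sequence
        -- and in its limit, to apply `limit-indicator-*`.
        (respʳ (sum-*-comm (λ i → A (from i) u) (λ i → U v (from i)))
          (resp (λ N → sum-*-comm (λ i → A (from i) u) (λ i → partialSum c N v (from i)))
            (limit-sum λ i → limit-indicator-* (from i) u (exp v (from i))))))

    -- The entry of `U` at `(σ u , u)` is `γ`. By symmetry so is the one at `(u , σ u)`, which puts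
    -- the 1 of column `σ u` in row `u`.
    involutive : ∀ u → σ.to (σ.to u) ≈ⱽ u
    involutive u = V.sym (scaled-indicator-injective P? P? γ≉0 (begin
      γ * permutationMatrix σ (σ.to u) u  ≈⟨ U≈γP (σ.to u) u ⟨
      U (σ.to u) u                        ≈⟨ U-symmetric (σ.to u) u ⟩
      U u (σ.to u)                        ≈⟨ U≈γP u (σ.to u) ⟩
      γ * permutationMatrix σ u (σ.to u)  ∎) V.refl)

    -- This is the entry at `(v , u)` of `A U = U A`. The factor `γ` is removed only when adjacency
    -- is read off.
    commutes : ∀ v u → γ * A v (σ.to u) ≈ γ * A (σ.from v) u
    commutes v u = begin
      γ * A v (σ.to u)                     ≈⟨ S.*-congˡ (⊗-permutationMatrix A-cong σ v u) ⟨
      γ * (A ⊗ permutationMatrix σ) v u    ≈⟨ ⊗-·ʳ γ A (permutationMatrix σ) v u ⟨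
      (A ⊗ (γ · permutationMatrix σ)) v u  ≈⟨ ⊗-cong (≈ᴹ-refl {A}) U≈γP v u ⟨
      (A ⊗ U) v u                          ≈⟨ U-commutes v u ⟩
      (U ⊗ A) v u                          ≈⟨ ⊗-cong U≈γP (≈ᴹ-refl {A}) v u ⟩
      ((γ · permutationMatrix σ) ⊗ A) v u  ≈⟨ ⊗-·ˡ γ (permutationMatrix σ) A v u ⟩
      γ * (permutationMatrix σ ⊗ A) v u    ≈⟨ S.*-congˡ (permutationMatrix-⊗ A-cong σ v u) ⟩
      γ * A (σ.from v) u                   ∎

    automorphism : ∀ u v → (u ~ v) ⇔ (σ.to u ~ σ.to v)
    automorphism u v = mk⇔
      (λ u~v → scaled-indicator-injective _~?_ _~?_ γ≉0 (S.sym (commutes (σ.to u) v))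
        (~-cong (V.sym (σ.strictlyInverseʳ u)) V.refl u~v))
      (λ σu~σv → ~-cong (σ.strictlyInverseʳ u) V.refl
        (scaled-indicator-injective _~?_ _~?_ γ≉0 (commutes (σ.to u) v) σu~σv))

    involutive-automorphism : (∀ u → σ.to (σ.to u) ≈ⱽ u) × (∀ u v → (u ~ v) ⇔ (σ.to u ~ σ.to v))
    involutive-automorphism = involutive , automorphism

-- Specialization to the complex numbers

isLimitℂ : IsLimit ℂᴿ.commutativeSemiring Limitℂ
isLimitℂ = record
  { resp   = limitℂ-resp-≈
  ; respʳ  = limitℂ-resp-≈ʳ
  ; unique = limitℂ-unique
  ; const  = limitℂ-const
  ; add    = λ { (mkLimitℂ p q) (mkLimitℂ p′ q′) → mkLimitℂ (limit-⊕ p p′) (limit-⊕ q q′) }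
  }

sum-of-squares-zero : {C : Set a} {_≈_ : Rel C ℓ} {_+_ _*_ : C → C → C} { -_ : C → C} {0# 1# : C} →
  IsCommutativeRing _≈_ _+_ _*_ -_ 0# 1# →
  ∀ {x y} → x ≈ 0# → y ≈ 0# → ((x * x) + (y * y)) ≈ 0#
sum-of-squares-zero isCommutativeRing {x} {y} x≈0 y≈0 =
  trans (+-cong (trans (*-congʳ x≈0) (zeroˡ x)) (trans (*-congʳ y≈0) (zeroˡ y))) (+-identityˡ _)
  where open IsCommutativeRing isCommutativeRing

hasModulus-1⇒≉0 : ∀ {w} → HasModulus w (CommutativeRing.1# ℝ-ring) → ¬ w ℂᴿ.≈ ℂᴿ.0#
hasModulus-1⇒≉0 {w} (_ , 1*1≈) (re≈0 , im≈0) = 1≉0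
  (ℝᴿ.trans (ℝᴿ.sym (ℝᴿ.*-identityˡ ℝᴿ.1#))
    (ℝᴿ.trans 1*1≈ (sum-of-squares-zero (CommutativeRing.isCommutativeRing ℝ-ring) {re w} {im w} re≈0 im≈0)))

module _ {V : Setoid a ℓ} {n : ℕ} (fin : HasSize V n) (X : Graph V e) (τ : ℝ) {T : Perm V} where

  private
    module M = MatrixAlgebra ℂᴿ.commutativeSemiring fin
    module PST = PerfectStateTransfer ℂᴿ.commutativeSemiring isLimitℂ fin X

    -- The general notions, taken over ℂ, agree with the given ones by computation. Here and in the
    -- following lemmas these comparisons are made separately, with the terms written out.
    powers : ∀ B → M.IsPowers B (Matrices._^_ fin B)
    powers B = record
      { pow-zero = λ v u → ℂᴿ.refl {Matrices.identity fin v u}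
      ; pow-suc  = λ k v u → ℂᴿ.refl {Matrices._^_ fin B (ℕ.suc k) v u}
      }

    exp-limit : ∀ B U → Matrices.IsExp fin B U →
      ∀ v u → Limitℂ (λ N → M.Powers.partialSum (powers B) (Matrices.1/_! fin) N v u) (U v u)
    exp-limit B U exp v u = convergesℂ⇒limitℂ {λ N → Matrices.expSum fin B N v u} {U v u} (exp v u)

    D≈A : ∀ v u → adjacencyMatrix fin X v u ℂᴿ.≈ PST.A v u
    D≈A v u = ℂᴿ.refl {adjacencyMatrix fin X v u}

    B≈zD : ∀ z v u → Matrices._·_ fin z (adjacencyMatrix fin X) v u ℂᴿ.≈ (z M.· adjacencyMatrix fin X) v u
    B≈zD z v u = ℂᴿ.refl {Matrices._·_ fin z (adjacencyMatrix fin X) v u}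

    P≈ : ∀ v u → Matrices.permutationMatrix fin T v u ℂᴿ.≈ M.permutationMatrix T v u
    P≈ v u = ℂᴿ.refl {Matrices.permutationMatrix fin T v u}

    U≈ : ∀ U γ → Matrices._≈ᴹ_ fin U (Matrices._·_ fin γ (Matrices.permutationMatrix fin T)) →
         ∀ v u → U v u ℂᴿ.≈ (γ M.· Matrices.permutationMatrix fin T) v u
    U≈ U γ U≈γP = U≈γP

    -- Perfect state transfer and the involution each come with their own transition matrix; this
    -- identifies the two.
    exp-unique : ∀ B U U′ → Matrices.IsExp fin B U → Matrices.IsExp fin B U′ → ∀ v u → U v u ℂᴿ.≈ U′ v u
    exp-unique B U U′ exp exp′ v u =
      limitℂ-unique {λ N → M.Powers.partialSum (powers B) (Matrices.1/_! fin) N v u} {U v u} {U′ v u}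
        (exp-limit B U exp v u) (exp-limit B U′ exp′ v u)

    U≈0 : ∀ U γ → γ ℂᴿ.≈ ℂᴿ.0# →
      Matrices._≈ᴹ_ fin U (Matrices._·_ fin γ (Matrices.permutationMatrix fin T)) → ∀ v u → U v u ℂᴿ.≈ ℂᴿ.0#
    U≈0 U γ γ≈0 U≈γP v u = ℂᴿ.trans {U v u} {(γ M.· Matrices.permutationMatrix fin T) v u} {ℂᴿ.0#}
      (U≈ U γ U≈γP v u) (M.·-zeroˡ {γ} γ≈0 (Matrices.permutationMatrix fin T) v u)

    -- With `γ ≈ 0` the matrix `U`, hence also `U′`, would be zero, against its entry of modulus 1.
    γ≉0 : HasPSTAt fin X τ → ∀ U → IsTransitionMatrix fin X τ U → ∀ γ →
      Matrices._≈ᴹ_ fin U (Matrices._·_ fin γ (Matrices.permutationMatrix fin T)) → ¬ γ ℂᴿ.≈ ℂᴿ.0#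
    γ≉0 (U′ , exp′ , u , v , _ , modulus) U exp γ U≈γP γ≈0 = hasModulus-1⇒≉0 {U′ v u} modulus
      (ℂᴿ.trans {U′ v u} {U v u} {ℂᴿ.0#}
        (exp-unique (Matrices._·_ fin (ℝᴿ.0# +i τ) (adjacencyMatrix fin X)) U′ U exp′ exp v u)
        (U≈0 U γ γ≈0 U≈γP v u))

  pst-involution : HasPSTAt fin X τ → IsPSTInvolutionAt fin X τ T →
    (∀ u → Setoid._≈_ V (Inverse.to T (Inverse.to T u)) u) × T ∈ Subgroup.member (Aut X)
  pst-involution pst (U , exp , γ , U≈γP) = PST.involutive-automorphism
    {ℝᴿ.0# +i τ} {Matrices._·_ fin (ℝᴿ.0# +i τ) (adjacencyMatrix fin X)} {adjacencyMatrix fin X}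
    (B≈zD (ℝᴿ.0# +i τ)) D≈A
    {Matrices._^_ fin (Matrices._·_ fin (ℝᴿ.0# +i τ) (adjacencyMatrix fin X))}
    (powers (Matrices._·_ fin (ℝᴿ.0# +i τ) (adjacencyMatrix fin X)))
    (Matrices.1/_! fin) {U}
    (exp-limit (Matrices._·_ fin (ℝᴿ.0# +i τ) (adjacencyMatrix fin X)) U exp)
    {T} {γ} (γ≉0 pst U exp γ U≈γP) {Matrices.permutationMatrix fin T} (U≈ U γ U≈γP) P≈

-- Generated and regular permutation groups

generated⊆ : {G : Group c ℓ} {P : Pred (Group.Carrier G) p} (K : Subgroup G e) →
             P ⊆ Subgroup.member K → Generated {G = G} P ⊆ Subgroup.member K
generated⊆ K P⊆K (gen x∈P)     = P⊆K x∈P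
generated⊆ K P⊆K unit          = Subgroup.ε-closed K
generated⊆ K P⊆K (mul p q)     = Subgroup.∙-closed K (generated⊆ K P⊆K p) (generated⊆ K P⊆K q)
generated⊆ K P⊆K (inv p)       = Subgroup.⁻¹-closed K (generated⊆ K P⊆K p)
generated⊆ K P⊆K (equal x≈y p) = Subgroup.resp K x≈y (generated⊆ K P⊆K p)

R∈Aut : (G : Group c ℓ) (S : ConnectionSet G e) → ∀ a → R G a ∈ Subgroup.member (Aut (Cay G S))
R∈Aut G S a u v = mk⇔ (resp (sym cancel)) (resp cancel)
  where
  open Group G
  open GroupProperties G
  open ConnectionSet S
  open SetoidReasoning setoid
  cancel : (v ∙ a) ∙ (u ∙ a) ⁻¹ ≈ v ∙ u ⁻¹
  cancel = begin
    (v ∙ a) ∙ (u ∙ a) ⁻¹     ≈⟨ ∙-congˡ (⁻¹-anti-homo-∙ u a) ⟩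
    (v ∙ a) ∙ (a ⁻¹ ∙ u ⁻¹)  ≈⟨ assoc v a _ ⟩
    v ∙ (a ∙ (a ⁻¹ ∙ u ⁻¹))  ≈⟨ ∙-congˡ (sym (assoc a _ _)) ⟩
    v ∙ ((a ∙ a ⁻¹) ∙ u ⁻¹)  ≈⟨ ∙-congˡ (trans (∙-congʳ (inverseʳ a)) (identityˡ _)) ⟩
    v ∙ u ⁻¹                 ∎

-- Evaluation at `x₀` is a bijection from `K` to the points: transitivity supplies preimages, and if
-- `σ` and `π` agree at `x₀`, then `π⁻¹ σ` fixes `x₀` and is trivial.
regular⇒order : {V : Setoid a ℓ} {K : Subgroup (Sym V) p} → IsRegular K →
                HasSize V n → Setoid.Carrier V → HasOrder K n
regular⇒order {V = V} {K} regular fin x₀ = record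
  { to        = λ (σ , _) → Inverse.to fin (Inverse.to σ x₀)
  ; from      = λ i → let (σ , σ∈K , _) = transitive x₀ (Inverse.from fin i) in σ , σ∈K
  ; to-cong   = λ σ≈π → Inverse.to-cong fin (σ≈π x₀)
  ; from-cong = λ { ≡.refl _ → V.refl }
  ; inverse   =
      (λ {i} {(σ , _)} σ≈ → Inverse.inverseˡ fin (V.trans (σ≈ x₀) (maps i)))
    , (λ {(σ , σ∈K)} {i} i≡ → agree _ σ (proj₁ (proj₂ (transitive x₀ (Inverse.from fin i)))) σ∈K
        (V.trans (maps i) (Inverse.inverseʳ fin i≡)))
  }
  where
  module V = Setoid V
  open IsRegular regular
  maps : ∀ i → Inverse.to (proj₁ (transitive x₀ (Inverse.from fin i))) x₀ V.≈ Inverse.from fin i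
  maps i = proj₂ (proj₂ (transitive x₀ (Inverse.from fin i)))
  agree : ∀ σ π → σ ∈ Subgroup.member K → π ∈ Subgroup.member K →
          Inverse.to σ x₀ V.≈ Inverse.to π x₀ → σ ≈ₚ π
  agree σ π σ∈K π∈K eq x = V.trans (V.sym (Inverse.strictlyInverseˡ π (Inverse.to σ x)))
    (Inverse.to-cong π (trivialStabilizer x₀
      (Subgroup.∙-closed K (Subgroup.⁻¹-closed K π∈K) σ∈K)
      (V.trans (Inverse.from-cong π eq) (Inverse.strictlyInverseʳ π x₀)) x))

-- An abelian subgroup of index two and an involution outside it

module IndexTwo (G : Group c ℓ) (H : Subgroup G h) (abelian : IsAbelian (Subgroup.group H))
  (index : HasIndex H 2) (s : Group.Carrier G) (s∉H : s ∉ Subgroup.member H)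
  (s²≈ε : Group._≈_ G (Group._∙_ G s s) (Group.ε G)) where

  open Group G
  open GroupProperties G
  open Subgroup H using (member; resp; ε-closed; ∙-closed; ⁻¹-closed)
  open MonoidSolver monoid using (solve; _⊕_; _⊜_)
  open SetoidReasoning setoid

  s^_ : Parity → Carrier
  s^ 0ℙ = ε
  s^ 1ℙ = s

  s^-homo : ∀ k l → s^ (k +ℙ l) ≈ s^ k ∙ s^ l
  s^-homo 0ℙ l  = sym (identityˡ _)
  s^-homo 1ℙ 0ℙ = sym (identityʳ s)
  s^-homo 1ℙ 1ℙ = sym s²≈ε

  s^-comm : ∀ k l → s^ k ∙ s^ l ≈ s^ l ∙ s^ k
  s^-comm k l = begin
    s^ k ∙ s^ l  ≈⟨ s^-homo k l ⟨
    s^ (k +ℙ l)  ≡⟨ ≡.cong s^_ (ℙ.+-comm k l) ⟩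
    s^ (l +ℙ k)  ≈⟨ s^-homo l k ⟩
    s^ l ∙ s^ k  ∎

  s^-involutive : ∀ k → s^ k ∙ s^ k ≈ ε
  s^-involutive 0ℙ = identityˡ ε
  s^-involutive 1ℙ = s²≈ε

  s^-⁻¹ : ∀ k → (s^ k) ⁻¹ ≈ s^ k
  s^-⁻¹ k = sym (inverseʳ-unique (s^ k) (s^ k) (s^-involutive k))

  s^-cancel : ∀ k x → s^ k ∙ (s^ k ∙ x) ≈ x
  s^-cancel k x = trans (sym (assoc _ _ x)) (trans (∙-congʳ (s^-involutive k)) (identityˡ x))

  private
    same-coset : ∀ {x y} → Inverse.to index x ≡ Inverse.to index y → x ⁻¹ ∙ y ∈ member
    same-coset {x} {y} eq = Setoid.trans cosets {x} {Inverse.from index (Inverse.to index y)} {y}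
      (Setoid.sym cosets {Inverse.from index (Inverse.to index y)} {x} (Inverse.inverseʳ index (≡.sym eq)))
      (Inverse.strictlyInverseʳ index y)
      where cosets = Subgroup.leftCosets H

    one-of-two : ∀ (i j k : Fin 2) → i ≢ j → k ≢ i → k ≡ j
    one-of-two 0F 0F k  i≢j k≢i = contradiction ≡.refl i≢j
    one-of-two 1F 1F k  i≢j k≢i = contradiction ≡.refl i≢j
    one-of-two 0F 1F 0F i≢j k≢i = contradiction ≡.refl k≢i
    one-of-two 0F 1F 1F i≢j k≢i = ≡.refl
    one-of-two 1F 0F 0F i≢j k≢i = ≡.refl
    one-of-two 1F 0F 1F i≢j k≢i = contradiction ≡.refl k≢i

  Decomposition : Carrier → Set _
  Decomposition x = ∃₂ λ k a → a ∈ member × s^ k ∙ a ≈ x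

  ε⁻¹∙ : ∀ x → ε ⁻¹ ∙ x ≈ x
  ε⁻¹∙ x = trans (∙-congʳ ε⁻¹≈ε) (identityˡ x)

  decompose : ∀ x → Decomposition x
  decompose x with Inverse.to index ε Fin.≟ Inverse.to index x
  ... | yes eq = 0ℙ , x , resp (ε⁻¹∙ x) (same-coset eq) , identityˡ x
  -- Neither `x` nor `s` lies in the coset of `ε`; only one other coset exists, so they share it and
  -- `s⁻¹ x` is in `H`.
  ... | no neq = 1ℙ , s ⁻¹ ∙ x
      , same-coset (≡.sym (one-of-two (Inverse.to index ε) _ _
          (λ eq → s∉H (resp (ε⁻¹∙ s) (same-coset eq))) (neq ∘ ≡.sym)))
      , trans (sym (assoc s _ x)) (trans (∙-congʳ (inverseʳ s)) (identityˡ x))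

  s-decomposed : ∀ {a b} → a ∈ member → b ∈ member → ¬ s ∙ a ≈ b
  s-decomposed {a} {b} a∈ b∈ eq = s∉H (resp (begin
    b ∙ a ⁻¹        ≈⟨ ∙-congʳ eq ⟨
    (s ∙ a) ∙ a ⁻¹  ≈⟨ assoc s a _ ⟩
    s ∙ (a ∙ a ⁻¹)  ≈⟨ ∙-congˡ (inverseʳ a) ⟩
    s ∙ ε           ≈⟨ identityʳ s ⟩
    s               ∎) (∙-closed b∈ (⁻¹-closed a∈)))

  decompose-unique : ∀ k l {a b} → a ∈ member → b ∈ member → s^ k ∙ a ≈ s^ l ∙ b → a ≈ b × k ≡ l
  decompose-unique 0ℙ 0ℙ a∈ b∈ eq = ∙-cancelˡ ε _ _ eq , ≡.refl
  decompose-unique 1ℙ 1ℙ a∈ b∈ eq = ∙-cancelˡ s _ _ eq , ≡.refl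
  decompose-unique 0ℙ 1ℙ a∈ b∈ eq = contradiction (trans (sym eq) (identityˡ _)) (s-decomposed b∈ a∈)
  decompose-unique 1ℙ 0ℙ a∈ b∈ eq = contradiction (trans eq (identityˡ _)) (s-decomposed a∈ b∈)

  K : Subgroup (Sym setoid) _
  K = ⟨R[ H ],L s ⟩

  NormalForm : Perm setoid → Set _
  NormalForm σ = ∃₂ λ k a → a ∈ member × (∀ x → Inverse.to σ x ≈ s^ k ∙ (x ∙ a))

  element : ∀ k {a} → a ∈ member →
            ∃ λ σ → σ ∈ Subgroup.member K × (∀ x → Inverse.to σ x ≈ s^ k ∙ (x ∙ a))
  element 0ℙ {a} a∈ = R G a , gen (inj₁ (a , a∈ , λ _ → refl)) , λ x → sym (identityˡ _)
  element 1ℙ {a} a∈ = Group._∙_ (Sym setoid) (L G s) (R G a)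
    , mul {x = L G s} {y = R G a} (gen (inj₂ λ _ → refl)) (gen (inj₁ (a , a∈ , λ _ → refl)))
    , λ x → refl

  compose : ∀ k l a b x → s^ k ∙ ((s^ l ∙ (x ∙ b)) ∙ a) ≈ (s^ k ∙ s^ l) ∙ (x ∙ (b ∙ a))
  compose k l a b x =
    solve 5 (λ p q x b a → p ⊕ ((q ⊕ (x ⊕ b)) ⊕ a) ⊜ (p ⊕ q) ⊕ (x ⊕ (b ⊕ a))) refl (s^ k) (s^ l) x b a

  -- Induction on generation. Left and right translations commute, so under composition the powers
  -- of `s` multiply while the right factors multiply in reverse order.
  normalForm : ∀ {σ} → σ ∈ Subgroup.member K → NormalForm σ
  normalForm (gen (inj₁ (a , a∈ , σ≈R))) = 0ℙ , a , a∈ , λ x → trans (σ≈R x) (sym (identityˡ _))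
  normalForm (gen (inj₂ σ≈L)) = 1ℙ , ε , ε-closed , λ x → trans (σ≈L x) (∙-congˡ (sym (identityʳ x)))
  normalForm unit = 0ℙ , ε , ε-closed , λ x → sym (trans (identityˡ _) (identityʳ x))
  normalForm (mul {σ} {π} σ∈ π∈) =
    let (k , a , a∈ , f) = normalForm σ∈
        (l , b , b∈ , g) = normalForm π∈
    in k +ℙ l , b ∙ a , ∙-closed b∈ a∈ , λ x → begin
      Inverse.to σ (Inverse.to π x)        ≈⟨ f _ ⟩
      s^ k ∙ (Inverse.to π x ∙ a)          ≈⟨ ∙-congˡ (∙-congʳ (g x)) ⟩
      s^ k ∙ ((s^ l ∙ (x ∙ b)) ∙ a)        ≈⟨ compose k l a b x ⟩
      (s^ k ∙ s^ l) ∙ (x ∙ (b ∙ a))        ≈⟨ ∙-congʳ (s^-homo k l) ⟨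
      s^ (k +ℙ l) ∙ (x ∙ (b ∙ a))          ∎
  normalForm (inv {σ} σ∈) =
    let (k , a , a∈ , f) = normalForm σ∈ in
    k , a ⁻¹ , ⁻¹-closed a∈ , λ x → Inverse.inverseʳ σ (sym (begin
      Inverse.to σ (s^ k ∙ (x ∙ a ⁻¹))      ≈⟨ f _ ⟩
      s^ k ∙ ((s^ k ∙ (x ∙ a ⁻¹)) ∙ a)      ≈⟨ compose k k a (a ⁻¹) x ⟩
      (s^ k ∙ s^ k) ∙ (x ∙ (a ⁻¹ ∙ a))      ≈⟨ ∙-cong (s^-involutive k) (∙-congˡ (inverseˡ a)) ⟩
      ε ∙ (x ∙ ε)                           ≈⟨ trans (identityˡ _) (identityʳ x) ⟩
      x                                     ∎))
  normalForm (equal σ≈π σ∈) =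
    let (k , a , a∈ , f) = normalForm σ∈ in k , a , a∈ , λ x → trans (sym (σ≈π x)) (f x)

  -- After left and right factors are separated, exchanging `σ` and `π` only swaps two powers of `s`
  -- and two elements of `H`.
  K-abelian : IsAbelian (Subgroup.group K)
  K-abelian (σ , σ∈) (π , π∈) x =
    let (k , a , a∈ , f) = normalForm σ∈
        (l , b , b∈ , g) = normalForm π∈
    in begin
      Inverse.to σ (Inverse.to π x)        ≈⟨ trans (f _) (∙-congˡ (∙-congʳ (g x))) ⟩
      s^ k ∙ ((s^ l ∙ (x ∙ b)) ∙ a)        ≈⟨ compose k l a b x ⟩
      (s^ k ∙ s^ l) ∙ (x ∙ (b ∙ a))        ≈⟨ ∙-cong (s^-comm k l) (∙-congˡ (abelian (b , b∈) (a , a∈))) ⟩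
      (s^ l ∙ s^ k) ∙ (x ∙ (a ∙ b))        ≈⟨ compose l k b a x ⟨
      s^ l ∙ ((s^ k ∙ (x ∙ a)) ∙ b)        ≈⟨ trans (g _) (∙-congˡ (∙-congʳ (f x))) ⟨
      Inverse.to π (Inverse.to σ x)        ∎

  K-regular : IsRegular K
  K-regular = record
    { transitive = λ x y →
        let (k , a , a∈ , x≈) = decompose x
            (l , b , b∈ , y≈) = decompose y
            -- For `x = sᵏ a`, the factors `sᵏ` on the left and `a⁻¹` on the right cancel `x`
            -- entirely; `sˡ` and `b` then build `y`.
            (σ , σ∈ , f) = element (l +ℙ k) (∙-closed (⁻¹-closed a∈) b∈)
        in σ , σ∈ , (begin
          Inverse.to σ x                               ≈⟨ f x ⟩
          s^ (l +ℙ k) ∙ (x ∙ (a ⁻¹ ∙ b))               ≈⟨ ∙-cong (s^-homo l k) (∙-congʳ (sym x≈)) ⟩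
          (s^ l ∙ s^ k) ∙ ((s^ k ∙ a) ∙ (a ⁻¹ ∙ b))    ≈⟨ solve 5 (λ p q a a′ b →
            (p ⊕ q) ⊕ ((q ⊕ a) ⊕ (a′ ⊕ b)) ⊜ p ⊕ (((q ⊕ q) ⊕ (a ⊕ a′)) ⊕ b)) refl (s^ l) (s^ k) a (a ⁻¹) b ⟩
          s^ l ∙ (((s^ k ∙ s^ k) ∙ (a ∙ a ⁻¹)) ∙ b)    ≈⟨ ∙-congˡ (∙-congʳ (∙-cong (s^-involutive k) (inverseʳ a))) ⟩
          s^ l ∙ ((ε ∙ ε) ∙ b)                         ≈⟨ ∙-congˡ (trans (∙-congʳ (identityˡ ε)) (identityˡ b)) ⟩
          s^ l ∙ b                                     ≈⟨ y≈ ⟩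
          y                                            ∎)
    ; trivialStabilizer = λ x {σ} σ∈ fixed →
        let (k , a , a∈ , f) = normalForm σ∈
            (j , b , b∈ , x≈) = decompose x
            -- With `x = sʲ b`, the fixed-point equation is `sᵏ sʲ b a = sʲ b`. Cancelling `sʲ`
            -- leaves two decompositions of `b`, whence `k = 0` and `a = ε`.
            (ba≈b , k≡0) = decompose-unique k 0ℙ (∙-closed b∈ a∈) b∈ (begin
              s^ k ∙ (b ∙ a)                         ≈⟨ s^-cancel j _ ⟨
              s^ j ∙ (s^ j ∙ (s^ k ∙ (b ∙ a)))       ≈⟨ ∙-congˡ
                (trans (sym (assoc _ _ _)) (trans (∙-congʳ (s^-comm j k)) (assoc _ _ _))) ⟩
              s^ j ∙ (s^ k ∙ (s^ j ∙ (b ∙ a)))       ≈⟨ ∙-congˡ (∙-congˡ (assoc _ _ _)) ⟨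
              s^ j ∙ (s^ k ∙ ((s^ j ∙ b) ∙ a))       ≈⟨ ∙-congˡ (∙-congˡ (∙-congʳ x≈)) ⟩
              s^ j ∙ (s^ k ∙ (x ∙ a))                ≈⟨ ∙-congˡ (f x) ⟨
              s^ j ∙ Inverse.to σ x                  ≈⟨ ∙-congˡ fixed ⟩
              s^ j ∙ x                               ≈⟨ ∙-congˡ x≈ ⟨
              s^ j ∙ (s^ j ∙ b)                      ≈⟨ s^-cancel j b ⟩
              b                                      ≈⟨ identityˡ b ⟨
              ε ∙ b                                  ∎)
        in λ y → begin
          Inverse.to σ y   ≈⟨ f y ⟩
          s^ k ∙ (y ∙ a)   ≈⟨ ∙-cong (reflexive (≡.cong s^_ k≡0)) (∙-congˡ (identityʳ-unique b a ba≈b)) ⟩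
          ε ∙ (y ∙ ε)      ≈⟨ trans (identityˡ _) (identityʳ y) ⟩
          y                ∎
    }

  H×C₂-abelian : IsAbelian (Subgroup.group H ×ᴳ C₂)
  H×C₂-abelian (x , k) (y , l) = abelian x y , ℙ.+-comm k l

  -- The graph as a Cayley graph of `H × C₂`

  module _ (S : ConnectionSet G e) (L∈Aut : L G s ∈ Subgroup.member (Aut (Cay G S))) where

    private module S = ConnectionSet S

    -- `L s` carries the edge from `ε` to `x` to the edge from `s` to `s x`, whose quotient is
    -- `s x s⁻¹ = s x s`.
    conjugate : ∀ k {x} → x ∈ S.member → s^ k ∙ (x ∙ s^ k) ∈ S.member
    conjugate 0ℙ {x} x∈ = S.resp (sym (trans (identityˡ _) (identityʳ x))) x∈
    conjugate 1ℙ {x} x∈ = S.resp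
      (begin
        (s ∙ x) ∙ (s ∙ ε) ⁻¹  ≈⟨ ∙-congˡ (⁻¹-cong (identityʳ s)) ⟩
        (s ∙ x) ∙ s ⁻¹        ≈⟨ ∙-congˡ (s^-⁻¹ 1ℙ) ⟩
        (s ∙ x) ∙ s           ≈⟨ assoc s x s ⟩
        s ∙ (x ∙ s)           ∎)
      (L∈Aut ε x .Equivalence.to (S.resp (sym (trans (∙-congˡ ε⁻¹≈ε) (identityʳ x))) x∈))

    connectionSet : ConnectionSet (Subgroup.group H ×ᴳ C₂) e
    connectionSet = record
      { member        = λ ((a , _) , k) → s^ k ∙ a ∈ S.member
      ; resp          = λ { (a≈b , ≡.refl) → S.resp (∙-congˡ a≈b) }
      ; member?       = λ ((a , _) , k) → S.member? (s^ k ∙ a)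
      ; 1∉            = λ ε∈ → S.1∉ (S.resp (identityˡ ε) ε∈)
      -- The inverse of `sᵏ a` in `G` is `a⁻¹ sᵏ`, whereas the inverse of `(a , k)` corresponds to
      -- `sᵏ a⁻¹`; conjugation by `sᵏ` turns one into the other.
      ; inverseClosed = λ { {((a , _) , k)} x∈ → S.resp
          (begin
            s^ k ∙ ((s^ k ∙ a) ⁻¹ ∙ s^ k)        ≈⟨ ∙-congˡ (∙-congʳ (⁻¹-anti-homo-∙ _ a)) ⟩
            s^ k ∙ ((a ⁻¹ ∙ (s^ k) ⁻¹) ∙ s^ k)   ≈⟨ ∙-congˡ (assoc _ _ _) ⟩
            s^ k ∙ (a ⁻¹ ∙ ((s^ k) ⁻¹ ∙ s^ k))   ≈⟨ ∙-congˡ (trans (∙-congˡ (inverseˡ _)) (identityʳ _)) ⟩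
            s^ k ∙ a ⁻¹                          ∎)
          (conjugate k (S.inverseClosed x∈)) }
      }

    coordinates : Inverse setoid (Group.setoid (Subgroup.group H ×ᴳ C₂))
    coordinates = record
      { to        = to′
      ; from      = from′
      -- `decompose` works on representatives; uniqueness of the decomposition makes it respect
      -- equality.
      ; to-cong   = λ {x} {y} x≈y → unique x (to′ y) (trans (from-to y) (sym x≈y))
      ; from-cong = λ {y} {z} → from′-cong {y} {z}
      ; inverse   = (λ {z} {x} x≈ → unique x z (sym x≈))
                  , (λ {x} {z} z≈ → trans (from′-cong {z} {to′ x} z≈) (from-to x))
      }
      where
      open Group (Subgroup.group H ×ᴳ C₂) using () renaming (Carrier to H×C₂; _≈_ to _≈′_)
      to′ : Carrier → H×C₂
      to′ x = let (k , a , a∈ , _) = decompose x in (a , a∈) , k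
      from′ : H×C₂ → Carrier
      from′ ((a , _) , k) = s^ k ∙ a
      from-to : ∀ x → from′ (to′ x) ≈ x
      from-to x = proj₂ (proj₂ (proj₂ (decompose x)))
      from′-cong : ∀ {y z} → y ≈′ z → from′ y ≈ from′ z
      from′-cong (a≈b , ≡.refl) = ∙-congˡ a≈b
      unique : ∀ x z → from′ z ≈ x → to′ x ≈′ z
      unique x ((b , b∈) , l) eq = let (k , a , a∈ , x≈) = decompose x in
        decompose-unique k l a∈ b∈ (trans x≈ (sym eq))

    -- For `u = sᵏ a` and `v = sˡ b`, the quotient `v u⁻¹ = sˡ b a⁻¹ sᵏ` is conjugated by `sᵏ` into
    -- the image of the quotient of coordinates `(b a⁻¹ , l + k)`.
    isCayleyGraphOf : IsCayleyGraphOf (Cay G S) (Subgroup.group H ×ᴳ C₂)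
    isCayleyGraphOf = connectionSet , coordinates , λ u v →
      let (k , a , a∈ , u≈) = decompose u
          (l , b , b∈ , v≈) = decompose v
          difference : s^ k ∙ ((v ∙ u ⁻¹) ∙ s^ k) ≈ s^ (l +ℙ k) ∙ (b ∙ a ⁻¹)
          difference = begin
            s^ k ∙ ((v ∙ u ⁻¹) ∙ s^ k)
              ≈⟨ ∙-congˡ (∙-congʳ (∙-cong (sym v≈) (trans (⁻¹-cong (sym u≈)) (⁻¹-anti-homo-∙ _ a)))) ⟩
            s^ k ∙ (((s^ l ∙ b) ∙ (a ⁻¹ ∙ (s^ k) ⁻¹)) ∙ s^ k)
              ≈⟨ solve 6 (λ p q b a′ p′ p″ →
                   p ⊕ (((q ⊕ b) ⊕ (a′ ⊕ p′)) ⊕ p″) ⊜ (p ⊕ q) ⊕ ((b ⊕ a′) ⊕ (p′ ⊕ p″)))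
                   refl (s^ k) (s^ l) b (a ⁻¹) ((s^ k) ⁻¹) (s^ k) ⟩
            (s^ k ∙ s^ l) ∙ ((b ∙ a ⁻¹) ∙ ((s^ k) ⁻¹ ∙ s^ k))
              ≈⟨ ∙-cong (s^-comm k l) (trans (∙-congˡ (inverseˡ _)) (identityʳ _)) ⟩
            (s^ l ∙ s^ k) ∙ (b ∙ a ⁻¹)
              ≈⟨ ∙-congʳ (s^-homo l k) ⟨
            s^ (l +ℙ k) ∙ (b ∙ a ⁻¹) ∎
          -- The converse conjugates once more, which undoes the first conjugation.
          double : s^ k ∙ ((s^ k ∙ ((v ∙ u ⁻¹) ∙ s^ k)) ∙ s^ k) ≈ v ∙ u ⁻¹
          double = begin
            s^ k ∙ ((s^ k ∙ ((v ∙ u ⁻¹) ∙ s^ k)) ∙ s^ k)  ≈⟨ compose k k (s^ k) (s^ k) (v ∙ u ⁻¹) ⟩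
            (s^ k ∙ s^ k) ∙ ((v ∙ u ⁻¹) ∙ (s^ k ∙ s^ k))  ≈⟨ ∙-cong (s^-involutive k) (∙-congˡ (s^-involutive k)) ⟩
            ε ∙ ((v ∙ u ⁻¹) ∙ ε)                          ≈⟨ trans (identityˡ _) (identityʳ _) ⟩
            v ∙ u ⁻¹                                      ∎
      in mk⇔ (λ u~v → S.resp difference (conjugate k u~v))
             (λ φu~φv → S.resp double (conjugate k (S.resp (sym difference) φu~φv)))

lemma5p4 : ∀ {c ℓ h e : Level} {n : ℕ} (G : Group c ℓ) (fin : HasSize (Group.setoid G) n)
    (H : Subgroup G h) → IsAbelian (Subgroup.group H) → HasIndex H 2 →
    (S : ConnectionSet G e) →
    (τ : ℝ) → HasPSTAt fin (Cay G S) τ →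
    (T : Perm (Group.setoid G)) → IsPSTInvolutionAt fin (Cay G S) τ T →
    (s : Group.Carrier G) → s ∉ Subgroup.member H → T ≈ₚ L G s →
    (Subgroup.member ⟨R[ H ],L s ⟩ ⊆ Subgroup.member (Aut (Cay G S)) ×
    IsAbelian (Subgroup.group ⟨R[ H ],L s ⟩) ×
    IsRegular ⟨R[ H ],L s ⟩ ×
    HasOrder ⟨R[ H ],L s ⟩ n) ×
    (IsAbelian (Subgroup.group H ×ᴳ C₂) ×
    IsCayleyGraphOf (Cay G S) (Subgroup.group H ×ᴳ C₂))
lemma5p4 G fin H abelian index S τ pst T isT s s∉H T≈L =
    ( generated⊆ {G = Sym setoid} (Aut (Cay G S)) (λ {σ} → generators∈Aut {σ})
    , K-abelian , K-regular , regular⇒order {K = K} K-regular fin ε )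
  , (H×C₂-abelian , isCayleyGraphOf S L∈Aut)
  where
  open Group G
  T-properties = pst-involution fin (Cay G S) τ {T} pst isT
  L∈Aut : L G s ∈ Subgroup.member (Aut (Cay G S))
  L∈Aut = Subgroup.resp (Aut (Cay G S)) {T} {L G s} T≈L (proj₂ T-properties)
  s²≈ε : s ∙ s ≈ ε
  s²≈ε = begin
    s ∙ s                          ≈⟨ ∙-congˡ (identityʳ s) ⟨
    s ∙ (s ∙ ε)                    ≈⟨ ∙-congˡ (T≈L ε) ⟨
    s ∙ Inverse.to T ε             ≈⟨ T≈L _ ⟨
    Inverse.to T (Inverse.to T ε)  ≈⟨ proj₁ T-properties ε ⟩
    ε                              ∎
    where open SetoidReasoning setoid
  open IndexTwo G H abelian index s s∉H s²≈ε
  generators∈Aut : R[ H ] ∪ (_≈ₚ L G s) ⊆ Subgroup.member (Aut (Cay G S))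
  generators∈Aut {σ} (inj₁ (a , _ , σ≈R)) =
    Subgroup.resp (Aut (Cay G S)) {R G a} {σ} (sym ∘ σ≈R) (R∈Aut G S a)
  generators∈Aut {σ} (inj₂ σ≈L) = Subgroup.resp (Aut (Cay G S)) {L G s} {σ} (sym ∘ σ≈L) L∈Aut
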